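{- Let $q$ be a prime power and $h\geq 2$ an integer. Then for each $t\in\{2,3\}$ there exists a $t$-fold blocking set of size $t(q^h+q^{h-1}+1)$ in $\mathrm{PG}(2,q^h)$.
   Context: $\mathrm{PG}(2,q^h)$ denotes the Desarguesian projective plane over $\mathbb{F}_{q^h}$. A $t$-fold blocking set is a set of points meeting every line in at least $t$ points. -}

module Defs where

open import Algebra.Bundles using (CommutativeRing)
open import Data.Fin using (Fin)
open import Data.Fin.Patterns using (0F; 1F; 2F)
open import Data.Nat using (ℕ; _≤_; _^_)
open import Data.Nat.Primality using (Prime)
open import Data.Product using (Σ; ∃; ∃₂; _×_; _,_; proj₁)
open import Data.Vec.Functional using (Vector)
open import Function.Bundles using (Injection; Inverse)
open import Level using (Level; _⊔_) renaming (suc to lsuc)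
open import Relation.Binary.Bundles using (Setoid)
open import Relation.Binary.Definitions using (_Respects_)
import Relation.Binary.Construct.On as On
open import Relation.Binary.PropositionalEquality using (_≡_)
import Relation.Binary.PropositionalEquality as ≡
import Relation.Binary.Reasoning.Setoid as SetoidReasoning
open import Relation.Nullary using (¬_)
open import Relation.Unary using (Pred; _∩_)

IsPrimePower : ℕ → Set
IsPrimePower q = ∃₂ λ p k → Prime p × 1 ≤ k × q ≡ p ^ k

HasSize : ∀ {a ℓ} → Setoid a ℓ → ℕ → Set (a ⊔ ℓ)
HasSize S n = Inverse (≡.setoid (Fin n)) S

HasAtLeast : ∀ {a ℓ} → Setoid a ℓ → ℕ → Set (a ⊔ ℓ)
HasAtLeast S n = Injection (≡.setoid (Fin n)) S

-- Elements are compared by their underlying element of S only; the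
-- membership proof is ignored.
subsetoid : ∀ {a ℓ p} (S : Setoid a ℓ) → Pred (Setoid.Carrier S) p → Setoid (a ⊔ p) ℓ
subsetoid S P = On.setoid {B = Σ (Setoid.Carrier S) P} S proj₁

record Field (c ℓ : Level) : Set (lsuc (c ⊔ ℓ)) where
  field
    commutativeRing : CommutativeRing c ℓ
  open CommutativeRing commutativeRing public
  field
    1≉0     : 1# ≉ 0#
    inverse : ∀ x → x ≉ 0# → ∃ λ y → x * y ≈ 1#

-- The Desarguesian plane PG(2,K) in homogeneous coordinates.
module PG2 {c ℓ : Level} (K : Field c ℓ) where
  open Field K

  NonZeroVector : Set (c ⊔ ℓ)
  NonZeroVector = Σ (Vector Carrier 3) λ v → ¬ (∀ i → v i ≈ 0#)

  Point : Set (c ⊔ ℓ)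
  Point = NonZeroVector

  -- The coefficient vector of a linear form; the line is its zero locus.
  Line : Set (c ⊔ ℓ)
  Line = NonZeroVector

  _∼_ : Point → Point → Set (c ⊔ ℓ)
  (u , _) ∼ (v , _) = ∃ λ k → k ≉ 0# × (∀ i → u i ≈ k * v i)

  _on_ : Point → Line → Set ℓ
  (v , _) on (a , _) = a 0F * v 0F + a 1F * v 1F + a 2F * v 2F ≈ 0#

  private
    open SetoidReasoning setoid

    ∼-refl : ∀ {P} → P ∼ P
    ∼-refl = 1# , 1≉0 , λ i → sym (*-identityˡ _)

    ∼-sym : ∀ {P Q} → P ∼ Q → Q ∼ P
    ∼-sym {u , _} {v , _} (k , k≉0 , u≈kv) with inverse k k≉0
    ... | k′ , kk′≈1 = k′ , k′≉0 , λ i → begin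
        v i              ≈⟨ *-identityˡ (v i) ⟨
        1# * v i         ≈⟨ *-congʳ kk′≈1 ⟨
        (k * k′) * v i   ≈⟨ *-congʳ (*-comm k k′) ⟩
        (k′ * k) * v i   ≈⟨ *-assoc k′ k (v i) ⟩
        k′ * (k * v i)   ≈⟨ *-congˡ (u≈kv i) ⟨
        k′ * u i         ∎
      where
      k′≉0 : k′ ≉ 0#
      k′≉0 k′≈0 = 1≉0 (trans (sym kk′≈1) (trans (*-congˡ k′≈0) (zeroʳ k)))

    ∼-trans : ∀ {P Q R} → P ∼ Q → Q ∼ R → P ∼ R
    ∼-trans {u , _} {v , _} {w , _} (k , k≉0 , u≈kv) (m , m≉0 , v≈mw) =
      k * m , km≉0 , λ i →
        trans (u≈kv i) (trans (*-congˡ (v≈mw i)) (sym (*-assoc k m (w i))))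
      where
      km≉0 : k * m ≉ 0#
      km≉0 km≈0 with inverse k k≉0
      ... | k′ , kk′≈1 = m≉0 (begin
        m              ≈⟨ *-identityˡ m ⟨
        1# * m         ≈⟨ *-congʳ kk′≈1 ⟨
        (k * k′) * m   ≈⟨ *-congʳ (*-comm k k′) ⟩
        (k′ * k) * m   ≈⟨ *-assoc k′ k m ⟩
        k′ * (k * m)   ≈⟨ *-congˡ km≈0 ⟩
        k′ * 0#        ≈⟨ zeroʳ k′ ⟩
        0#             ∎)

  pointSetoid : Setoid (c ⊔ ℓ) (c ⊔ ℓ)
  pointSetoid = record
    { Carrier       = Point
    ; _≈_           = _∼_
    ; isEquivalence = record
      { refl  = λ {P} → ∼-refl {P}
      ; sym   = λ {P} {Q} → ∼-sym {P} {Q}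
      ; trans = λ {P} {Q} {R} → ∼-trans {P} {Q} {R}
      }
    }

  record PointSet : Set (lsuc (c ⊔ ℓ)) where
    field
      member   : Pred Point (c ⊔ ℓ)
      respects : member Respects _∼_

  open PointSet public

  elements : PointSet → Setoid (c ⊔ ℓ) (c ⊔ ℓ)
  elements B = subsetoid pointSetoid (member B)

  IsBlockingSet : ℕ → PointSet → Set (c ⊔ ℓ)
  IsBlockingSet t B =
    ∀ (L : Line) → HasAtLeast (subsetoid pointSetoid (member B ∩ (_on L))) t

{-# OPTIONS --safe #-}
module Submission where

-- Let F = {x : x ^ q = x} and Tr : K → F the trace.  The F-linear set
--   B = {(Tr x + θ , x , ζ)} ∪ {(1 , z , 0) : Tr z = 1} ∪ {(0 , 1 , 0)},   θ ∉ F,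
-- has q ^ h + q ^ (h − 1) + 1 points and meets every line.  The collineation
-- σ (x , y , z) = (y , z , d x) has order 3, so B, σ B and σ² B are pairwise disjoint as
-- soon as B and σ B are.  For ζ = ν ω and d = ν ω² a common point of B and σ B forces
-- either Tr (ω θ) = 1 or Tr (ω (r + θ) (Tr x + θ)) = r with r ∈ F and x = ν / (r + θ).
-- Take ω with Tr (ω θ) = 0 and A = Tr ω, D = Tr (ω θ²) nonzero; writing w = 1 / r, the
-- second equation says that a map g : F → F of w takes a certain nonzero value v, where
-- v can be prescribed by rescaling ω.  One can choose ν with g 0 = g 1 = 0, so that g is
-- not onto, and let v be a missed value.

open import Defs
open import Data.Empty using (⊥; ⊥-elim)
open import Data.Fin as Fin using (Fin; zero; suc; toℕ; fromℕ; inject₁)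
open import Data.Fin.Patterns using (0F; 1F; 2F)
import Data.Fin.Permutation as Perm
import Data.Fin.Properties as Fin
open import Data.Nat as ℕ using (ℕ; zero; suc; _≤_; _<_; s≤s; z≤n)
open import Data.Nat.Combinatorics using (_C_; nCn≡1; nCk+nC[k+1]≡[n+1]C[k+1])
open import Data.Nat.Divisibility using (_∣_; divides; ∣⇒≤)
open import Data.Nat.Primality using (Prime; euclidsLemma; prime⇒nonTrivial)
import Data.Nat.Properties as ℕ
open import Data.Nat.Tactic.RingSolver using (solve-∀)
open import Data.Product using (Σ; ∃; ∃₂; _×_; _,_; proj₁; proj₂)
open import Data.Product.Function.NonDependent.Propositional using (_×-↔_)
open import Data.Sum using (_⊎_; inj₁; inj₂; [_,_]′)
open import Data.Sum.Function.Propositional using (_⊎-↔_)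
open import Data.Vec.Functional using (Vector; replicate; removeAt)
open import Function using (_∘_)
open import Function.Bundles using (Inverse; _↔_; mk↔ₛ′)
open import Function.Properties.Inverse using (↔-refl; ↔-trans)
open import Level using (Level; _⊔_)
open import Relation.Binary.Bundles using (Setoid)
open import Relation.Binary.Definitions using (Decidable; _Respects_)
open import Relation.Binary.PropositionalEquality as ≡ using (_≡_)
import Relation.Binary.Reasoning.Setoid as SetoidReasoning
open import Relation.Nullary using (¬_; Dec; yes; no; contradiction)
import Relation.Nullary.Decidable as Dec
import Relation.Unary as U

private
  variable
    ℓ₁ ℓ₂ ℓ₃ : Level

-- Divisibility of binomial coefficients by a prime

[1+k]*[1+n]C[1+k]≡[1+n]*nCk : ∀ n k → suc k ℕ.* (suc n C suc k) ≡ suc n ℕ.* (n C k)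
[1+k]*[1+n]C[1+k]≡[1+n]*nCk zero zero = ≡.refl
[1+k]*[1+n]C[1+k]≡[1+n]*nCk zero (suc k) = ℕ.*-zeroʳ (suc (suc k))
[1+k]*[1+n]C[1+k]≡[1+n]*nCk (suc n) zero
  rewrite ≡.sym (nCk+nC[k+1]≡[n+1]C[k+1] (suc n) 0)
        | ≡.sym (ℕ.*-identityˡ (suc n C 1))
        | [1+k]*[1+n]C[1+k]≡[1+n]*nCk n 0 = lemma n
  where
  lemma : ∀ n → 1 ℕ.* (1 ℕ.+ suc n ℕ.* 1) ≡ suc (suc n) ℕ.* 1
  lemma = solve-∀
[1+k]*[1+n]C[1+k]≡[1+n]*nCk (suc n) (suc k) = begin
  suc (suc k) ℕ.* (suc (suc n) C suc (suc k))
    ≡⟨ ≡.cong (suc (suc k) ℕ.*_) (nCk+nC[k+1]≡[n+1]C[k+1] (suc n) (suc k)) ⟨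
  suc (suc k) ℕ.* (X ℕ.+ (suc n C suc (suc k)))
    ≡⟨ lemma₁ k X (suc n C suc (suc k)) ⟩
  X ℕ.+ (suc k ℕ.* X ℕ.+ suc (suc k) ℕ.* (suc n C suc (suc k)))
    ≡⟨ ≡.cong₂ (λ u v → X ℕ.+ (u ℕ.+ v)) ([1+k]*[1+n]C[1+k]≡[1+n]*nCk n k)
         ([1+k]*[1+n]C[1+k]≡[1+n]*nCk n (suc k)) ⟩
  X ℕ.+ (suc n ℕ.* (n C k) ℕ.+ suc n ℕ.* (n C suc k))
    ≡⟨ ≡.cong (X ℕ.+_) (ℕ.*-distribˡ-+ (suc n) (n C k) (n C suc k)) ⟨
  X ℕ.+ suc n ℕ.* ((n C k) ℕ.+ (n C suc k))
    ≡⟨ ≡.cong (λ u → X ℕ.+ suc n ℕ.* u) (nCk+nC[k+1]≡[n+1]C[k+1] n k) ⟩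
  suc (suc n) ℕ.* X ∎
  where
  open ≡.≡-Reasoning
  X = suc n C suc k
  lemma₁ : ∀ k x y → suc (suc k) ℕ.* (x ℕ.+ y) ≡ x ℕ.+ (suc k ℕ.* x ℕ.+ suc (suc k) ℕ.* y)
  lemma₁ = solve-∀

-- By absorption the prime divides `suc k` times the coefficient, and it is too large to divide
-- `suc k` itself.
p∣pCk : ∀ {n k} → Prime (suc n) → k < n → suc n ∣ (suc n C suc k)
p∣pCk {n} {k} pr k<n
  with euclidsLemma (suc k) (suc n C suc k) pr
         (divides (n C k) (≡.trans ([1+k]*[1+n]C[1+k]≡[1+n]*nCk n k) (ℕ.*-comm (suc n) (n C k))))
... | inj₁ p∣k+1 = contradiction (∣⇒≤ p∣k+1) (ℕ.<⇒≱ (s≤s k<n))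
... | inj₂ p∣C = p∣C

-- Finite setoids and counting

bijection⇒HasSize : ∀ {S : Setoid ℓ₁ ℓ₂} {n} → let open Setoid S in
  (f : Fin n → Carrier) → (∀ {i j} → f i ≈ f j → i ≡ j) → (∀ y → ∃ λ i → f i ≈ y) →
  HasSize S n
bijection⇒HasSize {S = S} f f-inj f-surj = record
  { to        = f
  ; from      = proj₁ ∘ f-surj
  ; to-cong   = λ { ≡.refl → refl }
  ; from-cong = λ {x} {y} x≈y →
      f-inj (trans (proj₂ (f-surj x)) (trans x≈y (sym (proj₂ (f-surj y)))))
  ; inverse   = (λ { {x} ≡.refl → proj₂ (f-surj x) })
              , (λ {x} {y} y≈fx → f-inj (trans (proj₂ (f-surj y)) y≈fx))
  }
  where open Setoid S

enumerate : ∀ {n} {P : U.Pred (Fin n) ℓ₃} → U.Decidable P →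
  ∃ λ m → Σ (Fin m → Fin n) λ g →
    (∀ {i j} → g i ≡ g j → i ≡ j) × (∀ i → P (g i)) × (∀ x → P x → ∃ λ i → g i ≡ x)
enumerate {n = zero} P? = 0 , (λ ()) , (λ {i} → ⊥-elim (Fin.¬Fin0 i)) , (λ ()) , λ ()
enumerate {n = suc n} {P} P? with enumerate (P? ∘ suc) | P? zero
... | m , g , g-inj , g∈P , g-surj | no ¬P0 =
  m , suc ∘ g , g-inj ∘ Fin.suc-injective , g∈P , λ where
    zero    P0 → contradiction P0 ¬P0
    (suc x) Px → let i , gi≡x = g-surj x Px in i , ≡.cong suc gi≡x
... | m , g , g-inj , g∈P , g-surj | yes P0 =
  suc m , g′ , (λ {i} {j} → g′-inj i j) , g′∈P , λ where
    zero    _  → zero , ≡.refl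
    (suc x) Px → let i , gi≡x = g-surj x Px in suc i , ≡.cong suc gi≡x
  where
  g′ : Fin (suc m) → Fin (suc n)
  g′ zero    = zero
  g′ (suc i) = suc (g i)
  g′-inj : ∀ i j → g′ i ≡ g′ j → i ≡ j
  g′-inj zero    zero    _  = ≡.refl
  g′-inj (suc i) (suc j) eq = ≡.cong suc (g-inj (Fin.suc-injective eq))
  g′∈P : ∀ i → P (g′ i)
  g′∈P zero    = P0
  g′∈P (suc i) = g∈P i

-- A section of f can be extended by whichever of x, y it misses, which would
-- inject Fin (suc n) into Fin n.
Fin-collision⇒missed : ∀ {n} (f : Fin n → Fin n) {x y} → ¬ x ≡ y → f x ≡ f y →
  ∃ λ v → ∀ w → ¬ f w ≡ v
Fin-collision⇒missed {n} f {x} {y} x≢y fx≡fy =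
  let v , ¬hit = Fin.¬∀⟶∃¬ n (λ v → ∃ λ w → f w ≡ v) (λ v → Fin.any? λ w → f w Fin.≟ v) ¬onto
  in v , λ w eq → ¬hit (w , eq)
  where
  ¬onto : ¬ (∀ v → ∃ λ w → f w ≡ v)
  ¬onto hit = ℕ.1+n≰n (Fin.injective⇒≤ {f = s′} (λ {i} {j} → s′-inj i j))
    where
    s : Fin n → Fin n
    s = proj₁ ∘ hit
    fs : ∀ v → f (s v) ≡ v
    fs = proj₂ ∘ hit
    -- Any `u` in the image of `s` equals `s (f u)`. As `f x ≡ f y`, the distinct `x` and `y` cannot
    -- both be in that image.
    extra : ∃ λ u → ∀ v → ¬ u ≡ s v
    extra with x Fin.≟ s (f x)
    ... | no x≢s  = x , λ v x≡sv →
          x≢s (≡.trans x≡sv (≡.cong s (≡.trans (≡.sym (fs v)) (≡.cong f (≡.sym x≡sv)))))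
    ... | yes x≡s = y , λ v y≡sv → x≢y (≡.trans x≡s (≡.trans (≡.cong s
          (≡.trans fx≡fy (≡.trans (≡.cong f y≡sv) (fs v)))) (≡.sym y≡sv)))
    s′ : Fin (suc n) → Fin n
    s′ zero    = proj₁ extra
    s′ (suc v) = s v
    s′-inj : ∀ i j → s′ i ≡ s′ j → i ≡ j
    s′-inj zero    zero    _  = ≡.refl
    s′-inj zero    (suc j) eq = contradiction eq (proj₂ extra j)
    s′-inj (suc i) zero    eq = contradiction (≡.sym eq) (proj₂ extra i)
    s′-inj (suc i) (suc j) eq =
      ≡.cong suc (≡.trans (≡.sym (fs i)) (≡.trans (≡.cong f eq) (fs j)))

module _ {S : Setoid ℓ₁ ℓ₂} {n : ℕ} (size : HasSize S n) where
  open Setoid S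
  open Inverse size using (to; from; to-cong; from-cong; strictlyInverseˡ; strictlyInverseʳ)

  to-injective : ∀ {i j} → to i ≈ to j → i ≡ j
  to-injective {i} {j} eq =
    ≡.trans (≡.sym (strictlyInverseʳ i)) (≡.trans (from-cong eq) (strictlyInverseʳ j))

  from-injective : ∀ {x y} → from x ≡ from y → x ≈ y
  from-injective {x} {y} eq =
    trans (sym (strictlyInverseˡ x)) (trans (to-cong eq) (strictlyInverseˡ y))

  finite⇒≟ : Decidable _≈_
  finite⇒≟ x y = Dec.map′ from-injective from-cong (from x Fin.≟ from y)

  ¬∀⇒∃¬ : {P : U.Pred Carrier ℓ₃} → P Respects _≈_ → U.Decidable P →
    ¬ (∀ x → P x) → ∃ λ x → ¬ P x
  ¬∀⇒∃¬ {P = P} resp P? ¬∀ =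
    let i , ¬Pi = Fin.¬∀⟶∃¬ n (P ∘ to) (P? ∘ to)
                    (λ all → ¬∀ λ x → resp (strictlyInverseˡ x) (all (from x)))
    in to i , ¬Pi

  subset-finite : {P : U.Pred Carrier ℓ₃} → P Respects _≈_ → U.Decidable P →
    ∃ λ m → HasSize (subsetoid S P) m
  subset-finite {P = P} resp P? =
    let m , g , g-inj , g∈P , g-surj = enumerate (P? ∘ to) in
    m , bijection⇒HasSize {S = subsetoid S P} (λ i → to (g i) , g∈P i) (g-inj ∘ to-injective)
      λ (y , Py) →
        let i , gi≡y = g-surj (from y) (resp (sym (strictlyInverseˡ y)) Py)
        in i , trans (to-cong gi≡y) (strictlyInverseˡ y)

  collision⇒missed : (f : Carrier → Carrier) → (∀ {x y} → x ≈ y → f x ≈ f y) →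
    ∀ {x y} → ¬ x ≈ y → f x ≈ f y → ∃ λ v → ∀ w → ¬ f w ≈ v
  collision⇒missed f f-cong {x} {y} x≉y fx≈fy =
    let v , missed = Fin-collision⇒missed (from ∘ f ∘ to) (x≉y ∘ from-injective)
                       (from-cong (trans (f-cong (strictlyInverseˡ x))
                         (trans fx≈fy (sym (f-cong (strictlyInverseˡ y))))))
    in to v , λ w fw≈v → missed (from w)
         (≡.trans (from-cong (trans (f-cong (strictlyInverseˡ w)) fw≈v)) (strictlyInverseʳ v))

-- Fields, polynomial functions and Frobenius

module FieldProperties {c ℓ : Level} (K : Field c ℓ) (_≟_ : Decidable (Field._≈_ K)) where
  open Field K hiding (zero)
  open import Algebra.Properties.CommutativeSemiring.Exp commutativeSemiring
  open import Algebra.Properties.Semiring.Mult semiring as Mult using (×-assoc-*)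
  import Algebra.Properties.CommutativeSemiring.Binomial commutativeSemiring as Binomial
  import Algebra.Properties.CommutativeMonoid.Sum +-commutativeMonoid as Sum
  open import Algebra.Solver.Ring.NaturalCoefficients.Default commutativeSemiring
  open SetoidReasoning setoid

  *-cancelˡ-≉0 : ∀ {x y z} → x ≉ 0# → x * y ≈ x * z → y ≈ z
  *-cancelˡ-≉0 {x} {y} {z} x≉0 xy≈xz with inverse x x≉0
  ... | x′ , xx′≈1 = begin
    y            ≈⟨ unit y ⟨
    x′ * (x * y) ≈⟨ *-congˡ xy≈xz ⟩
    x′ * (x * z) ≈⟨ unit z ⟩
    z            ∎
    where
    unit : ∀ w → x′ * (x * w) ≈ w
    unit w = begin
      x′ * (x * w) ≈⟨ *-assoc x′ x w ⟨
      x′ * x * w   ≈⟨ *-congʳ (trans (*-comm x′ x) xx′≈1) ⟩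
      1# * w       ≈⟨ *-identityˡ w ⟩
      w            ∎

  *-≉0 : ∀ {x y} → x ≉ 0# → y ≉ 0# → x * y ≉ 0#
  *-≉0 {x} x≉0 y≉0 xy≈0 = y≉0 (*-cancelˡ-≉0 x≉0 (trans xy≈0 (sym (zeroʳ x))))

  xy≈1⇒x≉0 : ∀ {x y} → x * y ≈ 1# → x ≉ 0#
  xy≈1⇒x≉0 {x} {y} xy≈1 x≈0 = 1≉0 (trans (sym xy≈1) (trans (*-congʳ x≈0) (zeroˡ y)))

  ^-≉0 : ∀ {x} n → x ≉ 0# → x ^ n ≉ 0#
  ^-≉0 zero    x≉0 = 1≉0
  ^-≉0 (suc n) x≉0 = *-≉0 x≉0 (^-≉0 n x≉0)

  0^n≈0 : ∀ {n} → 1 ≤ n → 0# ^ n ≈ 0#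
  0^n≈0 {suc n} _ = zeroˡ _

  1^n≈1 : ∀ n → 1# ^ n ≈ 1#
  1^n≈1 zero    = refl
  1^n≈1 (suc n) = trans (*-identityˡ _) (1^n≈1 n)

  -- Polynomial functions of degree < d, and monic ones of degree d, in Horner form.
  Poly< : ℕ → (Carrier → Carrier) → Set (c ⊔ ℓ)
  Poly< zero    f = ∀ x → f x ≈ 0#
  Poly< (suc d) f = ∃₂ λ g a → Poly< d g × (∀ x → f x ≈ x * g x + a)

  Monic : ℕ → (Carrier → Carrier) → Set (c ⊔ ℓ)
  Monic zero    f = ∀ x → f x ≈ 1#
  Monic (suc d) f = ∃₂ λ g a → Monic d g × (∀ x → f x ≈ x * g x + a)

  Poly<-const : ∀ {d} a → 1 ≤ d → Poly< d (λ _ → a)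
  Poly<-const {suc d} a _ = (λ _ → 0#) , a , Poly<-0 d , λ x →
    sym (trans (+-congʳ (zeroʳ x)) (+-identityˡ a))
    where
    Poly<-0 : ∀ d → Poly< d (λ _ → 0#)
    Poly<-0 zero    = λ _ → refl
    Poly<-0 (suc d) = (λ _ → 0#) , 0# , Poly<-0 d , λ x →
      sym (trans (+-congʳ (zeroʳ x)) (+-identityˡ 0#))

  Poly<-+ : ∀ {d f g} → Poly< d f → Poly< d g → Poly< d (λ x → f x + g x)
  Poly<-+ {zero} f≈0 g≈0 x = trans (+-cong (f≈0 x) (g≈0 x)) (+-identityˡ 0#)
  Poly<-+ {suc d} (f , a , pf , f≈) (g , b , pg , g≈) =
    (λ x → f x + g x) , a + b , Poly<-+ pf pg , λ x →
      trans (+-cong (f≈ x) (g≈ x))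
        (solve 5 (λ x f a g b → (x :* f :+ a) :+ (x :* g :+ b) := x :* (f :+ g) :+ (a :+ b))
          refl x (f x) a (g x) b)

  Poly<-^ : ∀ {d} i → i < d → Poly< d (_^ i)
  Poly<-^ {suc d} zero    _         = Poly<-const 1# (s≤s z≤n)
  Poly<-^ {suc d} (suc i) (s≤s i<d) = (_^ i) , 0# , Poly<-^ i i<d , λ x → sym (+-identityʳ _)

  Poly<-linear : ∀ {d} a → 2 ≤ d → Poly< d (_* a)
  Poly<-linear {suc d} a (s≤s 1≤d) =
    (λ _ → a) , 0# , Poly<-const a 1≤d , λ x → sym (+-identityʳ _)

  Monic-^ : ∀ d → Monic d (_^ d)
  Monic-^ zero    = λ _ → refl
  Monic-^ (suc d) = (_^ d) , 0# , Monic-^ d , λ x → sym (+-identityʳ _)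

  Monic-+ : ∀ {d f g} → Monic d f → Poly< d g → Monic d (λ x → f x + g x)
  Monic-+ {zero} f≈1 g≈0 x = trans (+-cong (f≈1 x) (g≈0 x)) (+-identityʳ 1#)
  Monic-+ {suc d} (f , a , pf , f≈) (g , b , pg , g≈) =
    (λ x → f x + g x) , a + b , Monic-+ pf pg , λ x →
      trans (+-cong (f≈ x) (g≈ x))
        (solve 5 (λ x f a g b → (x :* f :+ a) :+ (x :* g :+ b) := x :* (f :+ g) :+ (a :+ b))
          refl x (f x) a (g x) b)

  -- f x − f r = (x − r) g x, with both sides moved so that no subtraction occurs.
  factor : ∀ {d f} → Monic (suc d) f → ∀ r →
    ∃ λ g → Monic d g × (∀ x → f x + r * g x ≈ x * g x + f r)
  factor {zero} {f} (g , a , g≈1 , f≈) r = g , g≈1 , λ x → begin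
    f x + r * g x           ≈⟨ +-cong (f≈ x) (*-congˡ (trans (g≈1 x) (sym (g≈1 r)))) ⟩
    x * g x + a + r * g r   ≈⟨ solve 3 (λ u a v → u :+ a :+ v := u :+ (v :+ a)) refl _ a _ ⟩
    x * g x + (r * g r + a) ≈⟨ +-congˡ (f≈ r) ⟨
    x * g x + f r           ∎
  factor {suc d} {f} (g , a , pg , f≈) r with factor pg r
  ... | g₁ , pg₁ , g≈ = (λ x → x * g₁ x + g r) , (g₁ , g r , pg₁ , λ _ → refl) , λ x → begin
    f x + r * (x * g₁ x + g r)
      ≈⟨ +-congʳ (f≈ x) ⟩
    x * g x + a + r * (x * g₁ x + g r)
      ≈⟨ solve 6 (λ x gx a r g₁ gr → x :* gx :+ a :+ r :* (x :* g₁ :+ gr)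
                   := x :* (gx :+ r :* g₁) :+ (r :* gr :+ a)) refl x (g x) a r (g₁ x) (g r) ⟩
    x * (g x + r * g₁ x) + (r * g r + a)
      ≈⟨ +-cong (*-congˡ (g≈ x)) (sym (f≈ r)) ⟩
    x * (x * g₁ x + g r) + f r ∎

  -- Induction on the degree: `factor` splits off the root `r zero`, and the other roots, being
  -- different from it, are roots of the cofactor.
  roots≤degree : ∀ {d f n} → Monic d f → (r : Fin n → Carrier) →
    (∀ {i j} → r i ≈ r j → i ≡ j) → (∀ i → f (r i) ≈ 0#) → n ≤ d
  roots≤degree {n = zero} _ _ _ _ = z≤n
  roots≤degree {zero} {n = suc n} f≈1 r _ root =
    contradiction (trans (sym (f≈1 (r zero))) (root zero)) 1≉0
  roots≤degree {suc d} {f} {suc n} mf r r-inj root with factor mf (r zero)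
  ... | g , mg , f≈ =
    s≤s (roots≤degree mg (r ∘ suc) (Fin.suc-injective ∘ r-inj) g-root)
    where
    r₀ = r zero
    g-root : ∀ i → g (r (suc i)) ≈ 0#
    g-root i with g (r (suc i)) ≟ 0#
    ... | yes g≈0 = g≈0
    -- Both values of `f` vanish, so `g x * r₀ ≈ g x * x`. Cancelling `g x` would identify two
    -- distinct roots.
    ... | no  g≉0 = contradiction (r-inj (*-cancelˡ-≉0 g≉0 (begin
      g x * r₀         ≈⟨ *-comm _ _ ⟩
      r₀ * g x         ≈⟨ +-identityˡ _ ⟨
      0# + r₀ * g x    ≈⟨ +-congʳ (root (suc i)) ⟨
      f x + r₀ * g x   ≈⟨ f≈ x ⟩
      x * g x + f r₀   ≈⟨ +-congˡ (root zero) ⟩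
      x * g x + 0#     ≈⟨ +-identityʳ _ ⟩
      x * g x          ≈⟨ *-comm _ _ ⟩
      g x * x          ∎))) λ ()
      where x = r (suc i)

  -- Additivity of powers in prime characteristic

  AdditivePower : ℕ → Set (c ⊔ ℓ)
  AdditivePower n = ∀ x y → (x + y) ^ n ≈ x ^ n + y ^ n

  AdditivePower-* : ∀ m n → AdditivePower m → AdditivePower n → AdditivePower (m ℕ.* n)
  AdditivePower-* m n am an x y = begin
    (x + y) ^ (m ℕ.* n)             ≈⟨ ^-assocʳ (x + y) m n ⟨
    ((x + y) ^ m) ^ n               ≈⟨ ^-congˡ n (am x y) ⟩
    (x ^ m + y ^ m) ^ n             ≈⟨ an (x ^ m) (y ^ m) ⟩
    (x ^ m) ^ n + (y ^ m) ^ n       ≈⟨ +-cong (^-assocʳ x m n) (^-assocʳ y m n) ⟩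
    x ^ (m ℕ.* n) + y ^ (m ℕ.* n)   ∎

  AdditivePower-^ : ∀ m → AdditivePower m → ∀ j → AdditivePower (m ℕ.^ j)
  AdditivePower-^ m am zero    x y = begin
    (x + y) * 1#    ≈⟨ distribʳ 1# x y ⟩
    x * 1# + y * 1# ∎
  AdditivePower-^ m am (suc j) = AdditivePower-* m (m ℕ.^ j) am (AdditivePower-^ m am j)

  -- In the binomial theorem only the two end terms survive: the inner coefficients are multiples of
  -- `p`, which is zero in the field.
  char⇒AdditivePower : ∀ {p} → Prime p → p Mult.× 1# ≈ 0# → AdditivePower p
  char⇒AdditivePower {suc n} pr p×1≈0 x y = begin
    (x + y) ^ suc n
      ≈⟨ Binomial.theorem (suc n) x y ⟩
    t zero + Sum.sum (t ∘ suc)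
      ≈⟨ +-congˡ (Sum.sum-init-last (t ∘ suc)) ⟩
    t zero + (Sum.sum (t ∘ suc ∘ inject₁) + t (suc (fromℕ n)))
      ≈⟨ +-cong first (+-cong (trans (Sum.sum-cong-≋ middle) (Sum.sum-replicate-zero n)) last) ⟩
    y ^ suc n + (0# + x ^ suc n)
      ≈⟨ solve 2 (λ x y → y :+ (con 0 :+ x) := x :+ y) refl _ _ ⟩
    x ^ suc n + y ^ suc n ∎
    where
    t : Fin (suc (suc n)) → Carrier
    t k = (suc n C toℕ k) Mult.× (x ^ toℕ k * y ^ (suc n ℕ.∸ toℕ k))
    first : t zero ≈ y ^ suc n
    first = trans (+-identityʳ _) (*-identityˡ _)
    last : t (suc (fromℕ n)) ≈ x ^ suc n
    last rewrite Fin.toℕ-fromℕ n | nCn≡1 (suc n) | ℕ.n∸n≡0 n =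
      trans (+-identityʳ _) (*-identityʳ _)
    p×z≈0 : ∀ z → suc n Mult.× z ≈ 0#
    p×z≈0 z = begin
      suc n Mult.× z          ≈⟨ Mult.×-congʳ (suc n) (*-identityˡ z) ⟨
      suc n Mult.× (1# * z)   ≈⟨ ×-assoc-* (suc n) 1# z ⟨
      (suc n Mult.× 1#) * z   ≈⟨ *-congʳ p×1≈0 ⟩
      0# * z                  ≈⟨ zeroˡ z ⟩
      0#                      ∎
    multiple : ∀ {m} z → suc n ∣ m → m Mult.× z ≈ 0#
    multiple z (divides k ≡.refl) = begin
      (k ℕ.* suc n) Mult.× z   ≡⟨ ≡.cong (Mult._× z) (ℕ.*-comm k (suc n)) ⟩
      (suc n ℕ.* k) Mult.× z   ≈⟨ Mult.×-assocˡ z (suc n) k ⟨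
      suc n Mult.× (k Mult.× z) ≈⟨ p×z≈0 _ ⟩
      0# ∎
    middle : ∀ i → t (suc (inject₁ i)) ≈ 0#
    middle i rewrite Fin.toℕ-inject₁ i = multiple _ (p∣pCk pr (Fin.toℕ<n i))

-- Finite fields

module FiniteField {c ℓ : Level} (K : Field c ℓ) {n : ℕ} (size : HasSize (Field.setoid K) n) where
  open Field K hiding (zero)
  open Inverse size using (to; from; to-cong; from-cong; strictlyInverseˡ; strictlyInverseʳ)
  open SetoidReasoning setoid
  open import Algebra.Properties.CommutativeSemiring.Exp commutativeSemiring
  open import Algebra.Properties.Semiring.Mult semiring as Mult using (×1-homo-*)
  import Algebra.Properties.CommutativeMonoid.Sum +-commutativeMonoid as Sum
  import Algebra.Properties.CommutativeMonoid.Sum *-commutativeMonoid as Product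
  open import Algebra.Properties.AbelianGroup +-abelianGroup using (∙-cancelˡ)

  infix 4 _≟_
  _≟_ : Decidable _≈_
  _≟_ = finite⇒≟ size

  open FieldProperties K _≟_ public

  -- 0 ⁻¹ = 0
  infix 9 _⁻¹
  _⁻¹ : Carrier → Carrier
  x ⁻¹ with x ≟ 0#
  ... | yes _   = 0#
  ... | no  x≉0 = proj₁ (inverse x x≉0)

  ⁻¹-inverseʳ : ∀ {x} → x ≉ 0# → x * x ⁻¹ ≈ 1#
  ⁻¹-inverseʳ {x} x≉0 with x ≟ 0#
  ... | yes x≈0 = contradiction x≈0 x≉0
  ... | no  x≉0 = proj₂ (inverse x x≉0)

  ⁻¹-≉0 : ∀ {x} → x ≉ 0# → x ⁻¹ ≉ 0#
  ⁻¹-≉0 {x} x≉0 x⁻¹≈0 = 1≉0 (trans (sym (⁻¹-inverseʳ x≉0)) (trans (*-congˡ x⁻¹≈0) (zeroʳ x)))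

  ⁻¹-cong : ∀ {x y} → x ≈ y → x ⁻¹ ≈ y ⁻¹
  ⁻¹-cong {x} {y} x≈y with x ≟ 0# | y ≟ 0#
  ... | yes _   | yes _   = refl
  ... | yes x≈0 | no  y≉0 = contradiction (trans (sym x≈y) x≈0) y≉0
  ... | no  x≉0 | yes y≈0 = contradiction (trans x≈y y≈0) x≉0
  ... | no  x≉0 | no  y≉0 = *-cancelˡ-≉0 x≉0 (trans (proj₂ (inverse x x≉0))
    (trans (sym (proj₂ (inverse y y≉0))) (*-congʳ (sym x≈y))))

  -- Carries a bijection of the field over to the indices, so that sums and products over the
  -- enumeration `to` can be reindexed by it.
  permutation : (f g : Carrier → Carrier) → (∀ {x y} → x ≈ y → f x ≈ f y) →
    (∀ {x y} → x ≈ y → g x ≈ g y) → (∀ x → f (g x) ≈ x) → (∀ x → g (f x) ≈ x) →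
    Perm.Permutation n n
  permutation f g f-cong g-cong fg gf = mk↔ₛ′ (from ∘ f ∘ to) (from ∘ g ∘ to)
    (λ i → ≡.trans (from-cong (trans (f-cong (strictlyInverseˡ _)) (fg (to i)))) (strictlyInverseʳ i))
    (λ i → ≡.trans (from-cong (trans (g-cong (strictlyInverseˡ _)) (gf (to i)))) (strictlyInverseʳ i))

  -- Translation by 1 permutes K, so it does not change the sum of all elements.
  size×1≈0 : n Mult.× 1# ≈ 0#
  size×1≈0 = sym (∙-cancelˡ (Sum.sum to) _ _ (begin
    Sum.sum to + 0#                           ≈⟨ +-identityʳ _ ⟩
    Sum.sum to                                ≈⟨ Sum.sum-permute to π ⟩
    Sum.sum (λ i → to (from (to i + 1#)))     ≈⟨ Sum.sum-cong-≋ {n} (λ i → strictlyInverseˡ (to i + 1#)) ⟩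
    Sum.sum (λ i → to i + 1#)                 ≈⟨ Sum.∑-distrib-+ to (replicate n 1#) ⟩
    Sum.sum to + Sum.sum (replicate n 1#)     ≈⟨ +-congˡ (Sum.sum-replicate n) ⟩
    Sum.sum to + n Mult.× 1#                  ∎))
    where
    cancel : ∀ {a b} → a + b ≈ 0# → ∀ x → x + a + b ≈ x
    cancel a+b≈0 x = trans (+-assoc x _ _) (trans (+-congˡ a+b≈0) (+-identityʳ x))
    π : Perm.Permutation n n
    π = permutation (_+ 1#) (_+ - 1#) +-congʳ +-congʳ
          (cancel (-‿inverseˡ 1#)) (cancel (-‿inverseʳ 1#))

  -- The multiple of one by `n` vanishes and is the `j`-th power of its multiple by `p`, but a field
  -- has no nonzero nilpotent elements.
  characteristic : ∀ {p} j → n ≡ p ℕ.^ j → p Mult.× 1# ≈ 0#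
  characteristic {p} j n≡p^j with p Mult.× 1# ≟ 0#
  ... | yes p≈0 = p≈0
  ... | no  p≉0 = contradiction (begin
    (p Mult.× 1#) ^ j   ≈⟨ power j ⟨
    (p ℕ.^ j) Mult.× 1# ≡⟨ ≡.cong (Mult._× 1#) n≡p^j ⟨
    n Mult.× 1#         ≈⟨ size×1≈0 ⟩
    0#                  ∎) (^-≉0 j p≉0)
    where
    power : ∀ j → (p ℕ.^ j) Mult.× 1# ≈ (p Mult.× 1#) ^ j
    power zero    = +-identityʳ 1#
    power (suc j) = trans (×1-homo-* p (p ℕ.^ j)) (*-congˡ (power j))

  product-≉0 : ∀ {m} (f : Fin m → Carrier) → (∀ i → f i ≉ 0#) → Product.sum f ≉ 0#
  product-≉0 {zero}  f f≉0 = 1≉0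
  product-≉0 {suc m} f f≉0 = *-≉0 (f≉0 zero) (product-≉0 (f ∘ suc) (f≉0 ∘ suc))

  -- Multiplication by x ≠ 0 permutes the nonzero elements; in the product over all
  -- of K the factor at 0 is replaced by 1.
  x^size≈x : ∀ x → x ^ n ≈ x
  x^size≈x x with x ≟ 0#
  ... | yes x≈0 = trans (^-congˡ n x≈0)
    (trans (0^n≈0 (ℕ.>-nonZero⁻¹ n ⦃ Fin.nonZeroIndex (from x) ⦄)) (sym x≈0))
  ... | no  x≉0 = go n ≡.refl
    where
    x′ = proj₁ (inverse x x≉0)
    xx′≈1 = proj₂ (inverse x x≉0)
    π : Perm.Permutation n n
    π = permutation (x *_) (x′ *_) *-congˡ *-congˡ (cancel xx′≈1)
          (cancel (trans (*-comm x′ x) xx′≈1))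
      where
      cancel : ∀ {a b} → a * b ≈ 1# → ∀ y → a * (b * y) ≈ y
      cancel ab≈1 y = trans (sym (*-assoc _ _ y)) (trans (*-congʳ ab≈1) (*-identityˡ y))
    unit : Carrier → Carrier
    unit y with y ≟ 0#
    ... | yes _ = 1#
    ... | no  _ = y
    unit≉0 : ∀ y → unit y ≉ 0#
    unit≉0 y with y ≟ 0#
    ... | yes _   = 1≉0
    ... | no  y≉0 = y≉0
    -- The factor that `unit` picks up under multiplication by `x`; at zero nothing changes.
    scale : Carrier → Carrier
    scale y with y ≟ 0#
    ... | yes _ = 1#
    ... | no  _ = x
    unit-scale : ∀ {y z} → z ≈ x * y → unit z ≈ scale y * unit y
    unit-scale {y} {z} z≈xy with y ≟ 0# | z ≟ 0#
    ... | yes _   | yes _   = sym (*-identityˡ 1#)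
    ... | yes y≈0 | no  z≉0 = contradiction (trans z≈xy (trans (*-congˡ y≈0) (zeroʳ x))) z≉0
    ... | no  y≉0 | yes z≈0 = contradiction (trans (sym z≈xy) z≈0) (*-≉0 x≉0 y≉0)
    ... | no  _   | no  _   = z≈xy
    scale-≈0 : ∀ {y} → y ≈ 0# → scale y ≈ 1#
    scale-≈0 {y} y≈0 with y ≟ 0#
    ... | yes _   = refl
    ... | no  y≉0 = contradiction y≈0 y≉0
    scale-≉0 : ∀ {y} → y ≉ 0# → scale y ≈ x
    scale-≉0 {y} y≉0 with y ≟ 0#
    ... | yes y≈0 = contradiction y≈0 y≉0
    ... | no  _   = refl
    Πunit = Product.sum (unit ∘ to)
    -- Reindexing by `π` multiplies the nonzero product `Πunit` by the product of `scale` and leaves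
    -- it unchanged.
    Πscale≈1 : Product.sum (scale ∘ to) ≈ 1#
    Πscale≈1 = sym (*-cancelˡ-≉0 (product-≉0 (unit ∘ to) (unit≉0 ∘ to)) (begin
      Πunit * 1#
        ≈⟨ *-identityʳ _ ⟩
      Πunit
        ≈⟨ Product.sum-permute (unit ∘ to) π ⟩
      Product.sum (λ i → unit (to (from (x * to i))))
        ≈⟨ Product.sum-cong-≋ {n} (λ i → unit-scale (strictlyInverseˡ (x * to i))) ⟩
      Product.sum (λ i → scale (to i) * unit (to i))
        ≈⟨ Product.∑-distrib-+ (scale ∘ to) (unit ∘ to) ⟩
      Product.sum (scale ∘ to) * Πunit
        ≈⟨ *-comm _ _ ⟩
      Πunit * Product.sum (scale ∘ to) ∎))
    -- Writing `n` as a successor allows the index of zero to be removed. Its factor in the product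
    -- of `scale` is one, and the other `m` factors are all `x`.
    go : ∀ m → m ≡ n → x ^ n ≈ x
    go zero    ≡.refl = contradiction (from x) Fin.¬Fin0
    go (suc m) ≡.refl = begin
      x * x ^ m
        ≈⟨ *-congˡ (Product.sum-replicate m) ⟨
      x * Product.sum (replicate m x)
        ≈⟨ *-congˡ (Product.sum-cong-≋ λ i → sym (scale-≉0 λ eq →
             Fin.punchInᵢ≢i z i (to-injective size (trans eq (sym (strictlyInverseˡ 0#)))))) ⟩
      x * Product.sum (removeAt (scale ∘ to) z)
        ≈⟨ *-congˡ (*-identityˡ _) ⟨
      x * (1# * Product.sum (removeAt (scale ∘ to) z))
        ≈⟨ *-congˡ (*-congʳ (scale-≈0 (strictlyInverseˡ 0#))) ⟨
      x * (scale (to z) * Product.sum (removeAt (scale ∘ to) z))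
        ≈⟨ *-congˡ (Product.sum-remove (scale ∘ to)) ⟨
      x * Product.sum (scale ∘ to)
        ≈⟨ *-congˡ Πscale≈1 ⟩
      x * 1#
        ≈⟨ *-identityʳ x ⟩
      x ∎
      where z = from 0#

-- The trace

-- An interface to the subfield F and the trace onto it that hides all exponents; the choice of
-- parameters and the construction rest on these properties. `f` counts the elements of trace one.
record TraceMap {c ℓ : Level} (K : Field c ℓ) (f : ℕ) : Set (Level.suc (c ⊔ ℓ)) where
  open Field K
  field
    F          : Carrier → Set ℓ
    F-resp     : F Respects _≈_
    0∈F        : F 0#
    1∈F        : F 1#
    F-+        : ∀ {x y} → F x → F y → F (x + y)
    F-*        : ∀ {x y} → F x → F y → F (x * y)
    F-neg      : ∀ {x} → F x → F (- x)
    F-inverse  : ∀ {x y} → x * y ≈ 1# → F x → F y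
    F-finite   : ∃ λ n → HasSize (subsetoid setoid F) n
    ∃∉F        : ∃ λ θ → ¬ F θ
    Tr         : Carrier → Carrier
    Tr-cong    : ∀ {x y} → x ≈ y → Tr x ≈ Tr y
    Tr-+       : ∀ x y → Tr (x + y) ≈ Tr x + Tr y
    Tr-*       : ∀ {a} → F a → ∀ x → Tr (a * x) ≈ a * Tr x
    Tr∈F       : ∀ x → F (Tr x)
    ∃Tr≈1      : ∃ λ e → Tr e ≈ 1#
    fibre-size : HasSize (subsetoid setoid (λ z → Tr z ≈ 1#)) f

-- Here h is `suc m`, so `1 ≤ m` says that h is at least 2, which makes F a proper subfield.
module Trace {c ℓ : Level} (K : Field c ℓ) {p k m : ℕ} (p-prime : Prime p) (1≤k : 1 ≤ k) (1≤m : 1 ≤ m)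
  (size : HasSize (Field.setoid K) ((p ℕ.^ k) ℕ.^ suc m)) where

  open Field K hiding (zero)
  open FiniteField K size
  open Inverse size using (to)
  open SetoidReasoning setoid
  open import Algebra.Properties.CommutativeSemiring.Exp commutativeSemiring
  open import Algebra.Properties.AbelianGroup +-abelianGroup
    using (∙-cancelʳ; inverseˡ-unique)
  open import Algebra.Properties.Ring ring using (-1*x≈-x)
  open import Algebra.Solver.Ring.NaturalCoefficients.Default commutativeSemiring

  q : ℕ
  q = p ℕ.^ k

  1<q : 1 < q
  1<q = ℕ.≤-<-trans (ℕ.≤-reflexive (≡.sym (ℕ.^-zeroˡ k)))
          (ℕ.^-monoˡ-< k ⦃ ℕ.>-nonZero 1≤k ⦄ (ℕ.nonTrivial⇒n>1 p ⦃ prime⇒nonTrivial p-prime ⦄))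

  1≤q^i : ∀ i → 1 ≤ q ℕ.^ i
  1≤q^i i = ℕ.m^n>0 q ⦃ ℕ.>-nonZero (ℕ.<⇒≤ 1<q) ⦄ i

  q^i-additive : ∀ i → AdditivePower (q ℕ.^ i)
  q^i-additive = AdditivePower-^ q (AdditivePower-^ p
    (char⇒AdditivePower p-prime (characteristic (k ℕ.* suc m) (ℕ.^-*-assoc p k (suc m)))) k)

  q-additive : AdditivePower q
  q-additive = ≡.subst AdditivePower (ℕ.^-identityʳ q) (q^i-additive 1)

  F : Carrier → Set ℓ
  F x = x ^ q ≈ x

  F-resp : F Respects _≈_
  F-resp x≈y x∈F = trans (^-congˡ q (sym x≈y)) (trans x∈F x≈y)

  0∈F : F 0#
  0∈F = 0^n≈0 (ℕ.<⇒≤ 1<q)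

  1∈F : F 1#
  1∈F = 1^n≈1 q

  F-+ : ∀ {x y} → F x → F y → F (x + y)
  F-+ x∈F y∈F = trans (q-additive _ _) (+-cong x∈F y∈F)

  F-* : ∀ {x y} → F x → F y → F (x * y)
  F-* x∈F y∈F = trans (^-distrib-* _ _ q) (*-cong x∈F y∈F)

  F-neg : ∀ {x} → F x → F (- x)
  F-neg {x} x∈F = inverseˡ-unique ((- x) ^ q) x (begin
    (- x) ^ q + x     ≈⟨ +-congˡ x∈F ⟨
    (- x) ^ q + x ^ q ≈⟨ q-additive (- x) x ⟨
    (- x + x) ^ q     ≈⟨ ^-congˡ q (-‿inverseˡ x) ⟩
    0# ^ q            ≈⟨ 0∈F ⟩
    0#                ∎)

  F-inverse : ∀ {x y} → x * y ≈ 1# → F x → F y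
  F-inverse {x} {y} xy≈1 x∈F = *-cancelˡ-≉0 (xy≈1⇒x≉0 xy≈1) (begin
    x * y ^ q      ≈⟨ *-congʳ x∈F ⟨
    x ^ q * y ^ q  ≈⟨ ^-distrib-* x y q ⟨
    (x * y) ^ q    ≈⟨ ^-congˡ q xy≈1 ⟩
    1# ^ q         ≈⟨ 1∈F ⟩
    1#             ≈⟨ xy≈1 ⟨
    x * y          ∎)

  F-^ : ∀ {x} i → F x → x ^ (q ℕ.^ i) ≈ x
  F-^ zero    x∈F = *-identityʳ _
  F-^ (suc i) x∈F = trans (sym (^-assocʳ _ q (q ℕ.^ i))) (trans (^-congˡ (q ℕ.^ i) x∈F) (F-^ i x∈F))

  -- F consists of roots of the monic polynomial X ^ q - X.
  F-count≤q : ∀ {n} (r : Fin n → Carrier) → (∀ {i j} → r i ≈ r j → i ≡ j) → (∀ i → F (r i)) → n ≤ q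
  F-count≤q r r-inj r∈F =
    roots≤degree (Monic-+ (Monic-^ q) (Poly<-linear (- 1#) 1<q)) r r-inj λ i → begin
      r i ^ q + r i * - 1#   ≈⟨ +-cong (r∈F i) (trans (*-comm _ _) (-1*x≈-x (r i))) ⟩
      r i + - r i            ≈⟨ -‿inverseʳ (r i) ⟩
      0#                     ∎

  -- Otherwise F would have all q ^ (m + 1) elements of the field, more than q.
  ∃∉F : ∃ λ θ → ¬ F θ
  ∃∉F = ¬∀⇒∃¬ size F-resp (λ x → x ^ q ≟ x) λ all →
    ℕ.<⇒≱ q<Q (F-count≤q to (to-injective size) (all ∘ to))
    where
    q<Q : q < q ℕ.^ suc m
    q<Q = ≡.subst (_< q ℕ.^ suc m) (ℕ.^-identityʳ q) (ℕ.^-monoʳ-< q 1<q (s≤s 1≤m))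

  -- The trace cut off after `i` terms. A free `i` allows induction over the terms, and `powerSum m`
  -- is the trace without its leading power.
  powerSum : ℕ → Carrier → Carrier
  powerSum zero    x = 0#
  powerSum (suc i) x = powerSum i x + x ^ (q ℕ.^ i)

  Tr : Carrier → Carrier
  Tr = powerSum (suc m)

  Tr-cong : ∀ {x y} → x ≈ y → Tr x ≈ Tr y
  Tr-cong {x} {y} x≈y = go (suc m)
    where
    go : ∀ i → powerSum i x ≈ powerSum i y
    go zero    = refl
    go (suc i) = +-cong (go i) (^-congˡ (q ℕ.^ i) x≈y)

  Tr-+ : ∀ x y → Tr (x + y) ≈ Tr x + Tr y
  Tr-+ x y = go (suc m)
    where
    go : ∀ i → powerSum i (x + y) ≈ powerSum i x + powerSum i y
    go zero    = sym (+-identityˡ 0#)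
    go (suc i) = trans (+-cong (go i) (q^i-additive i x y))
      (solve 4 (λ a b c d → (a :+ b) :+ (c :+ d) := (a :+ c) :+ (b :+ d))
        refl (powerSum i x) (powerSum i y) (x ^ (q ℕ.^ i)) (y ^ (q ℕ.^ i)))

  Tr-* : ∀ {a} → F a → ∀ x → Tr (a * x) ≈ a * Tr x
  Tr-* {a} a∈F x = go (suc m)
    where
    go : ∀ i → powerSum i (a * x) ≈ a * powerSum i x
    go zero    = sym (zeroʳ a)
    go (suc i) = trans (+-cong (go i) (trans (^-distrib-* a x (q ℕ.^ i)) (*-congʳ (F-^ i a∈F))))
      (sym (distribˡ a _ _))

  -- Raising to the power `q` shifts the conjugates of `x` by one place: `x` drops out at the
  -- bottom, and at the top x ^ (q ^ (m + 1)) appears, which is `x` again.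
  Tr∈F : ∀ x → F (Tr x)
  Tr∈F x = ∙-cancelʳ x _ _ (trans (go (suc m)) (+-congˡ (x^size≈x x)))
    where
    go : ∀ i → powerSum i x ^ q + x ≈ powerSum i x + x ^ (q ℕ.^ i)
    go zero    = +-cong 0∈F (sym (*-identityʳ x))
    go (suc i) = begin
      (powerSum i x + y) ^ q + x       ≈⟨ +-congʳ (q-additive _ y) ⟩
      powerSum i x ^ q + y ^ q + x     ≈⟨ solve 3 (λ a b c → a :+ b :+ c := (a :+ c) :+ b)
                                            refl (powerSum i x ^ q) (y ^ q) x ⟩
      (powerSum i x ^ q + x) + y ^ q   ≈⟨ +-cong (go i) (trans (^-assocʳ x (q ℕ.^ i) q)
                                            (^-congʳ x (ℕ.*-comm (q ℕ.^ i) q))) ⟩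
      (powerSum i x + y) + x ^ (q ℕ.^ suc i) ∎
      where y = x ^ (q ℕ.^ i)

  -- Tr X - `a` is a monic polynomial of degree q ^ m, its lower powers forming `powerSum m`.
  fibre≤q^m : ∀ {n} a (r : Fin n → Carrier) → (∀ {i j} → r i ≈ r j → i ≡ j) →
    (∀ i → Tr (r i) ≈ a) → n ≤ q ℕ.^ m
  fibre≤q^m a r r-inj Tr≈a =
    roots≤degree (Monic-+ (Monic-^ (q ℕ.^ m)) (Poly<-+ (lower m ℕ.≤-refl) (Poly<-const (- a) (1≤q^i m))))
      r r-inj λ i → begin
        r i ^ (q ℕ.^ m) + (powerSum m (r i) + - a)
          ≈⟨ solve 3 (λ x y z → x :+ (y :+ z) := (y :+ x) :+ z)
               refl (r i ^ (q ℕ.^ m)) (powerSum m (r i)) (- a) ⟩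
        Tr (r i) + - a
          ≈⟨ +-congʳ (Tr≈a i) ⟩
        a + - a
          ≈⟨ -‿inverseʳ a ⟩
        0# ∎
    where
    lower : ∀ i → i ≤ m → Poly< (q ℕ.^ m) (powerSum i)
    lower zero    _   = Poly<-const 0# (1≤q^i m)
    lower (suc i) i<m =
      Poly<-+ (lower i (ℕ.<⇒≤ i<m)) (Poly<-^ (q ℕ.^ i) (ℕ.^-monoʳ-< q 1<q i<m))

  abstract
    -- The trace has at most q ^ m zeros, so it is nonzero at some element. Dividing that element by
    -- its trace, a member of F, gives trace one.
    ∃Tr≈1 : ∃ λ e → Tr e ≈ 1#
    ∃Tr≈1 =
      let e , Tre≉0 = ¬∀⇒∃¬ size (λ x≈y → trans (Tr-cong (sym x≈y))) (λ x → Tr x ≟ 0#) λ all →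
            ℕ.<⇒≱ (ℕ.^-monoʳ-< q 1<q (ℕ.n<1+n m)) (fibre≤q^m 0# to (to-injective size) (all ∘ to))
      in Tr e ⁻¹ * e , (begin
        Tr (Tr e ⁻¹ * e)  ≈⟨ Tr-* (F-inverse (⁻¹-inverseʳ Tre≉0) (Tr∈F e)) e ⟩
        Tr e ⁻¹ * Tr e    ≈⟨ *-comm _ _ ⟩
        Tr e * Tr e ⁻¹    ≈⟨ ⁻¹-inverseʳ Tre≉0 ⟩
        1#                ∎)

  abstract
    F-finite : ∃ λ n → HasSize (subsetoid setoid F) n
    F-finite = subset-finite size F-resp (λ x → x ^ q ≟ x)

  Fibre : Setoid (c ⊔ ℓ) ℓ
  Fibre = subsetoid setoid (λ z → Tr z ≈ 1#)

  abstract
    fibre-finite : ∃ λ f → HasSize Fibre f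
    fibre-finite = subset-finite size (λ x≈y → trans (Tr-cong (sym x≈y))) (λ x → Tr x ≟ 1#)

  -- x ↦ (Tr x , x + (1 − Tr x) e) embeds K into F × Fibre, so both
  -- upper bounds |F| ≤ q and |Fibre| ≤ q ^ m are attained.
  fibre-size : HasSize Fibre (q ℕ.^ m)
  fibre-size = ≡.subst (HasSize Fibre) (ℕ.≤-antisym f≤q^m q^m≤f) fibre
    where
    e = proj₁ ∃Tr≈1
    Tr-e = proj₂ ∃Tr≈1
    n = proj₁ F-finite
    F-size = proj₂ F-finite
    f = proj₁ fibre-finite
    fibre = proj₂ fibre-finite
    module F′ = Inverse F-size
    module R = Inverse fibre
    f≤q^m : f ≤ q ℕ.^ m
    f≤q^m = fibre≤q^m 1# (proj₁ ∘ R.to) (to-injective fibre) (proj₂ ∘ R.to)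
    n≤q : n ≤ q
    n≤q = F-count≤q (proj₁ ∘ F′.to) (to-injective F-size) (proj₂ ∘ F′.to)
    -- The coefficient of `e` lies in F and makes up for the difference between `Tr x` and one.
    shift : Carrier → Carrier
    shift x = x + (1# + - Tr x) * e
    Tr-shift : ∀ x → Tr (shift x) ≈ 1#
    Tr-shift x = begin
      Tr (x + (1# + - Tr x) * e)      ≈⟨ Tr-+ x _ ⟩
      Tr x + Tr ((1# + - Tr x) * e)   ≈⟨ +-congˡ (Tr-* (F-+ 1∈F (F-neg (Tr∈F x))) e) ⟩
      Tr x + (1# + - Tr x) * Tr e     ≈⟨ +-congˡ (trans (*-congˡ Tr-e) (*-identityʳ _)) ⟩
      Tr x + (1# + - Tr x)            ≈⟨ solve 2 (λ a b → a :+ (con 1 :+ b) := con 1 :+ (a :+ b))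
                                           refl (Tr x) (- Tr x) ⟩
      1# + (Tr x + - Tr x)            ≈⟨ +-congˡ (-‿inverseʳ _) ⟩
      1# + 0#                         ≈⟨ +-identityʳ 1# ⟩
      1#                              ∎
    pair : Fin (q ℕ.^ suc m) → Fin (n ℕ.* f)
    pair i = Fin.combine (F′.from (Tr (to i) , Tr∈F (to i))) (R.from (shift (to i) , Tr-shift (to i)))
    pair-injective : ∀ {i j} → pair i ≡ pair j → i ≡ j
    pair-injective {i} {j} eq =
      let eq₁ , eq₂ = Fin.combine-injective _ _ _ _ eq
          -- Equal traces give equal multiples of `e` in `shift`, which then cancel.
          Tr≈ = from-injective F-size eq₁
      in to-injective size (∙-cancelʳ ((1# + - Tr (to j)) * e) _ _ (trans
           (+-congˡ (*-congʳ (+-congˡ (-‿cong (sym Tr≈))))) (from-injective fibre eq₂)))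
    q^m≤f : q ℕ.^ m ≤ f
    -- From q * q ^ m ≤ `n` * `f` ≤ q * `f`.
    q^m≤f = ℕ.*-cancelˡ-≤ q ⦃ ℕ.>-nonZero (ℕ.<⇒≤ 1<q) ⦄
      (ℕ.≤-trans (Fin.injective⇒≤ {f = pair} pair-injective) (ℕ.*-monoˡ-≤ f n≤q))

  traceMap : TraceMap K (q ℕ.^ m)
  traceMap = record
    { F = F ; F-resp = F-resp ; 0∈F = 0∈F ; 1∈F = 1∈F ; F-+ = F-+ ; F-* = F-* ; F-neg = F-neg
    ; F-inverse = F-inverse ; F-finite = F-finite ; ∃∉F = ∃∉F
    ; Tr = Tr ; Tr-cong = Tr-cong ; Tr-+ = Tr-+ ; Tr-* = Tr-* ; Tr∈F = Tr∈F
    ; ∃Tr≈1 = ∃Tr≈1 ; fibre-size = fibre-size }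

-- Choice of θ, ω and ν

module Choice {c ℓ : Level} (K : Field c ℓ) {n : ℕ} (size : HasSize (Field.setoid K) n)
  {f : ℕ} (T : TraceMap K f) where

  open Field K hiding (zero)
  open FiniteField K size
  open TraceMap T
  open SetoidReasoning setoid
  open import Algebra.Properties.AbelianGroup +-abelianGroup using (inverseʳ-unique; x∙y⁻¹≈ε⇒x≈y)
  open import Algebra.Properties.Ring ring using (-‿distribˡ-*)
  open import Algebra.Solver.Ring.NaturalCoefficients.Default commutativeSemiring

  e : Carrier
  e = proj₁ ∃Tr≈1

  Tr-e : Tr e ≈ 1#
  Tr-e = proj₂ ∃Tr≈1

  F-⁻¹ : ∀ {x} → x ≉ 0# → F x → F (x ⁻¹)
  F-⁻¹ x≉0 = F-inverse (⁻¹-inverseʳ x≉0)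

  Tr-0 : Tr 0# ≈ 0#
  Tr-0 = trans (Tr-cong (sym (zeroˡ 0#))) (trans (Tr-* 0∈F 0#) (zeroˡ _))

  x-y≈0⇒x≈y : ∀ {x y} → x + - y ≈ 0# → x ≈ y
  x-y≈0⇒x≈y = x∙y⁻¹≈ε⇒x≈y _ _

  Tr-+-* : ∀ {a} → F a → ∀ x y → Tr (x + a * y) ≈ Tr x + a * Tr y
  Tr-+-* a∈F x y = trans (Tr-+ x _) (+-congˡ (Tr-* a∈F y))

  -- The forms sending ω to `Tr (ω * v)` and `Tr (ω * u)` are independent over F, so the values 0
  -- and 1 can be prescribed together. The witness comes from a Gram-Schmidt step for the trace
  -- form.
  separate : ∀ {u v} → v ≉ 0# → (∀ {a} → F a → u ≉ a * v) →
    ∃ λ ω → Tr (ω * v) ≈ 0# × Tr (ω * u) ≈ 1#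
  separate {u} {v} v≉0 u∉Fv = ω₁ + - b * ω₀ , Tr-ωv , Tr-ωu
    where
    dual : ∀ {y} → y ≉ 0# → Tr (e * y ⁻¹ * y) ≈ 1#
    dual {y} y≉0 = trans (Tr-cong (trans (*-assoc e _ y)
      (trans (*-congˡ (trans (*-comm _ y) (⁻¹-inverseʳ y≉0))) (*-identityʳ e)))) Tr-e
    ω₀ = e * v ⁻¹
    a = Tr (ω₀ * u)
    -- This makes `Tr (ω₀ * d)` zero: subtracting a multiple of `ω₀` from `ω₁` corrects the value at
    -- `v` without changing the value 1 at `d`.
    d = u + - a * v
    d≉0 : d ≉ 0#
    d≉0 d≈0 = u∉Fv (Tr∈F _) (x-y≈0⇒x≈y (trans (+-congˡ (-‿distribˡ-* a v)) d≈0))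
    ω₁ = e * d ⁻¹
    b = Tr (ω₁ * v)
    -b∈F : F (- b)
    -b∈F = F-neg (Tr∈F _)
    expand : ∀ y → Tr ((ω₁ + - b * ω₀) * y) ≈ Tr (ω₁ * y) + - b * Tr (ω₀ * y)
    expand y = trans
      (Tr-cong (trans (distribʳ y ω₁ (- b * ω₀)) (+-congˡ (*-assoc (- b) ω₀ y))))
      (Tr-+-* -b∈F (ω₁ * y) (ω₀ * y))
    Tr-ωv : Tr ((ω₁ + - b * ω₀) * v) ≈ 0#
    Tr-ωv = begin
      Tr ((ω₁ + - b * ω₀) * v)  ≈⟨ expand v ⟩
      b + - b * Tr (ω₀ * v)     ≈⟨ +-congˡ (trans (*-congˡ (dual v≉0)) (*-identityʳ (- b))) ⟩
      b + - b                   ≈⟨ -‿inverseʳ b ⟩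
      0#                        ∎
    Tr-ωu : Tr ((ω₁ + - b * ω₀) * u) ≈ 1#
    Tr-ωu = begin
      Tr ((ω₁ + - b * ω₀) * u)        ≈⟨ expand u ⟩
      Tr (ω₁ * u) + - b * a           ≈⟨ +-congˡ (trans (sym (-‿distribˡ-* b a))
                                           (trans (-‿cong (*-comm b a)) (-‿distribˡ-* a b))) ⟩
      Tr (ω₁ * u) + - a * b           ≈⟨ Tr-+-* (F-neg (Tr∈F _)) (ω₁ * u) (ω₁ * v) ⟨
      Tr (ω₁ * u + - a * (ω₁ * v))    ≈⟨ Tr-cong (solve 4 (λ o u a v →
                                           o :* u :+ a :* (o :* v) := o :* (u :+ a :* v))
                                           refl ω₁ u (- a) v) ⟩
      Tr (ω₁ * d)                     ≈⟨ dual d≉0 ⟩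
      1#                              ∎

  -- `Tr-ωθ` and `avoid` exclude the two nontrivial ways in which B can meet σ B. In `avoid`, `x`
  -- comes from the point of B and `r` is the trace belonging to the point moved by σ.
  record Parameters : Set (c ⊔ ℓ) where
    field
      θ ω ν : Carrier
      r+θ≉0 : ∀ {r} → F r → r + θ ≉ 0#
      ω≉0   : ω ≉ 0#
      ν≉0   : ν ≉ 0#
      Tr-ωθ : Tr (ω * θ) ≈ 0#
      avoid : ∀ x {r} → F r → x * (r + θ) ≈ ν → Tr (ω * ((r + θ) * (Tr x + θ))) ≉ r

  module _ {θ : Carrier} (θ∉F : ¬ F θ) where
    r+θ≉0 : ∀ {r} → F r → r + θ ≉ 0#
    r+θ≉0 {r} r∈F r+θ≈0 = θ∉F (F-resp (sym (inverseʳ-unique r θ r+θ≈0)) (F-neg r∈F))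
    θ≉0 : θ ≉ 0#
    θ≉0 θ≈0 = θ∉F (F-resp (sym θ≈0) 0∈F)

    1∉Fθ : ∀ {a} → F a → 1# ≉ a * θ
    1∉Fθ {a} a∈F 1≈aθ = θ∉F (F-resp
      (*-cancelˡ-≉0 a≉0 (trans (⁻¹-inverseʳ a≉0) 1≈aθ)) (F-⁻¹ a≉0 a∈F))
      where
      a≉0 : a ≉ 0#
      a≉0 a≈0 = 1≉0 (trans 1≈aθ (trans (*-congʳ a≈0) (zeroˡ θ)))
    θ²∉Fθ : ∀ {a} → F a → θ * θ ≉ a * θ
    θ²∉Fθ a∈F θθ≈aθ = θ∉F (F-resp (sym (*-cancelˡ-≉0 θ≉0 (trans θθ≈aθ (*-comm _ θ)))) a∈F)

    -- One choice orthogonal to θ handles the first condition, another the last. If each fails the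
    -- other condition, their sum satisfies both.
    ∃ω : ∃ λ ω → Tr (ω * 1#) ≉ 0# × Tr (ω * θ) ≈ 0# × Tr (ω * (θ * θ)) ≉ 0#
    ∃ω =
      let ω₁ , ω₁θ , ω₁1 = separate θ≉0 1∉Fθ
          ω₂ , ω₂θ , ω₂θ² = separate θ≉0 θ²∉Fθ
      in combine ω₁θ ω₁1 ω₂θ ω₂θ² (Tr (ω₁ * (θ * θ)) ≟ 0#) (Tr (ω₂ * 1#) ≟ 0#)
      where
      ≈1⇒≉0 : ∀ {x} → x ≈ 1# → x ≉ 0#
      ≈1⇒≉0 x≈1 x≈0 = 1≉0 (trans (sym x≈1) x≈0)
      combine : ∀ {ω₁ ω₂} → Tr (ω₁ * θ) ≈ 0# → Tr (ω₁ * 1#) ≈ 1# →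
        Tr (ω₂ * θ) ≈ 0# → Tr (ω₂ * (θ * θ)) ≈ 1# →
        Dec (Tr (ω₁ * (θ * θ)) ≈ 0#) → Dec (Tr (ω₂ * 1#) ≈ 0#) →
        ∃ λ ω → Tr (ω * 1#) ≉ 0# × Tr (ω * θ) ≈ 0# × Tr (ω * (θ * θ)) ≉ 0#
      combine ω₁θ ω₁1 ω₂θ ω₂θ² (no ω₁θ²≉0) _ = _ , ≈1⇒≉0 ω₁1 , ω₁θ , ω₁θ²≉0
      combine ω₁θ ω₁1 ω₂θ ω₂θ² (yes _) (no ω₂1≉0) = _ , ω₂1≉0 , ω₂θ , ≈1⇒≉0 ω₂θ²
      combine {ω₁} {ω₂} ω₁θ ω₁1 ω₂θ ω₂θ² (yes ω₁θ²) (yes ω₂1) = ω₁ + ω₂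
        , ≈1⇒≉0 (trans (add 1#) (trans (+-cong ω₁1 ω₂1) (+-identityʳ 1#)))
        , trans (add θ) (trans (+-cong ω₁θ ω₂θ) (+-identityʳ 0#))
        , ≈1⇒≉0 (trans (add (θ * θ)) (trans (+-cong ω₁θ² ω₂θ²) (+-identityˡ 1#)))
        where
        add : ∀ y → Tr ((ω₁ + ω₂) * y) ≈ Tr (ω₁ * y) + Tr (ω₂ * y)
        add y = trans (Tr-cong (distribʳ y ω₁ ω₂)) (Tr-+ _ _)

    module _ {ω : Carrier} (A≉0 : Tr (ω * 1#) ≉ 0#) (Tr-ωθ : Tr (ω * θ) ≈ 0#)
      (D≉0 : Tr (ω * (θ * θ)) ≉ 0#) where

      A D : Carrier
      A = Tr (ω * 1#)
      D = Tr (ω * (θ * θ))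

      ω≉0 : ω ≉ 0#
      ω≉0 ω≈0 = A≉0 (trans (Tr-cong (trans (*-congʳ ω≈0) (zeroˡ 1#))) Tr-0)
      -D≉0 : - D ≉ 0#
      -D≉0 -D≈0 = D≉0 (trans (sym (+-identityʳ D)) (trans (+-congˡ (sym -D≈0)) (-‿inverseʳ D)))
      e≉0 : e ≉ 0#
      e≉0 e≈0 = 1≉0 (trans (sym Tr-e) (trans (Tr-cong e≈0) Tr-0))

      -- Chosen so that g 0 ≈ g 1, hence g is not onto F.
      ν₀ = - D * (e * (1# + θ))
      ν₀≉0 : ν₀ ≉ 0#
      ν₀≉0 = *-≉0 -D≉0 (*-≉0 e≉0 (r+θ≉0 1∈F))
      -- For `w` = 1 / r the fraction w / (1 + w θ) is 1 / (r + θ); in this form it is also defined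
      -- at `w` = 0, which corresponds to r at infinity.
      g : Carrier → Carrier
      g w = Tr (ν₀ * (w * (1# + w * θ) ⁻¹)) + D * w
      g-cong : ∀ {w w′} → w ≈ w′ → g w ≈ g w′
      g-cong w≈w′ = +-cong (Tr-cong (*-congˡ (*-cong w≈w′ (⁻¹-cong (+-congˡ (*-congʳ w≈w′)))))) (*-congˡ w≈w′)
      g∈F : ∀ {w} → F w → F (g w)
      g∈F w∈F = F-+ (Tr∈F _) (F-* (Tr∈F _) w∈F)
      g0≈0 : g 0# ≈ 0#
      g0≈0 = begin
        Tr (ν₀ * (0# * _)) + D * 0# ≈⟨ +-cong (trans (Tr-cong (trans (*-congˡ (zeroˡ _)) (zeroʳ _))) Tr-0) (zeroʳ D) ⟩
        0# + 0#                     ≈⟨ +-identityʳ 0# ⟩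
        0#                          ∎
      g1≈0 : g 1# ≈ 0#
      g1≈0 = begin
        Tr (ν₀ * (1# * s ⁻¹)) + D * 1#   ≈⟨ +-cong (Tr-cong ν₀/s) (*-identityʳ D) ⟩
        Tr (- D * e) + D                 ≈⟨ +-congʳ (Tr-* (F-neg (Tr∈F _)) e) ⟩
        - D * Tr e + D                   ≈⟨ +-congʳ (trans (*-congˡ Tr-e) (*-identityʳ _)) ⟩
        - D + D                          ≈⟨ -‿inverseˡ D ⟩
        0#                               ∎
        where
        s = 1# + 1# * θ
        s≈ : s ≈ 1# + θ
        s≈ = +-congˡ (*-identityˡ θ)
        ν₀/s : ν₀ * (1# * s ⁻¹) ≈ - D * e
        ν₀/s = begin
          - D * (e * (1# + θ)) * (1# * s ⁻¹) ≈⟨ *-congʳ (*-congˡ (*-congˡ s≈)) ⟨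
          - D * (e * s) * (1# * s ⁻¹)        ≈⟨ solve 4 (λ a b c d → a :* (b :* c) :* (con 1 :* d)
                                                  := a :* b :* (c :* d)) refl (- D) e s (s ⁻¹) ⟩
          - D * e * (s * s ⁻¹)               ≈⟨ *-congˡ (⁻¹-inverseʳ (λ s≈0 → r+θ≉0 1∈F (trans (sym s≈) s≈0))) ⟩
          - D * e * 1#                       ≈⟨ *-identityʳ _ ⟩
          - D * e                            ∎

      missed : ∃ λ ((v , _) : Σ Carrier F) → ((w , _) : Σ Carrier F) → g w ≉ v
      missed = collision⇒missed (proj₂ F-finite) (λ (w , w∈F) → g w , g∈F w∈F) g-cong
        {0# , 0∈F} {1# , 1∈F} (λ 0≈1 → 1≉0 (sym 0≈1)) (trans g0≈0 (sym g1≈0))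

      module _ {v : Carrier} (v∈F : F v) (v-missed : ∀ {w} → F w → g w ≉ v) where

        v≉0 : v ≉ 0#
        v≉0 v≈0 = v-missed 0∈F (trans g0≈0 (sym v≈0))
        v⁻¹∈F : F (v ⁻¹)
        v⁻¹∈F = F-⁻¹ v≉0 v∈F

        -- With a = Tr x, the excluded equation becomes D + r a A = v r. Division by r turns it into
        -- A a + D w = v, whose left side is `g w`.
        avoid : ∀ x {r} → F r → x * (r + θ) ≈ A ⁻¹ * ν₀ →
          Tr (v ⁻¹ * ω * ((r + θ) * (Tr x + θ))) ≉ r
        avoid x {r} r∈F x[r+θ]≈ν Tr≈r = absurd
          where
          a = Tr x
          a∈F = Tr∈F x
          -- The coefficient of r + a drops out because `Tr (ω * θ)` is zero.
          Tr-expand : Tr (v ⁻¹ * ω * ((r + θ) * (a + θ))) ≈ v ⁻¹ * (D + (r * a) * A)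
          Tr-expand = begin
            Tr (v ⁻¹ * ω * ((r + θ) * (a + θ)))
              ≈⟨ Tr-cong (solve 5 (λ v ω r a θ → v :* ω :* ((r :+ θ) :* (a :+ θ))
                   := v :* (ω :* (θ :* θ) :+ (r :+ a) :* (ω :* θ) :+ (r :* a) :* (ω :* con 1)))
                   refl (v ⁻¹) ω r a θ) ⟩
            Tr (v ⁻¹ * (ω * (θ * θ) + (r + a) * (ω * θ) + (r * a) * (ω * 1#)))
              ≈⟨ Tr-* v⁻¹∈F _ ⟩
            v ⁻¹ * Tr (ω * (θ * θ) + (r + a) * (ω * θ) + (r * a) * (ω * 1#))
              ≈⟨ *-congˡ (trans (Tr-+-* (F-* r∈F a∈F) _ _) (+-congʳ (Tr-+-* (F-+ r∈F a∈F) _ _))) ⟩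
            v ⁻¹ * (D + (r + a) * Tr (ω * θ) + (r * a) * A)
              ≈⟨ *-congˡ (+-congʳ (trans (+-congˡ (trans (*-congˡ Tr-ωθ) (zeroʳ _))) (+-identityʳ D))) ⟩
            v ⁻¹ * (D + (r * a) * A) ∎
          D+raA≈vr : D + (r * a) * A ≈ v * r
          D+raA≈vr = begin
            D + (r * a) * A                  ≈⟨ *-identityˡ _ ⟨
            1# * (D + (r * a) * A)           ≈⟨ *-congʳ (⁻¹-inverseʳ v≉0) ⟨
            v * v ⁻¹ * (D + (r * a) * A)     ≈⟨ *-assoc v (v ⁻¹) _ ⟩
            v * (v ⁻¹ * (D + (r * a) * A))   ≈⟨ *-congˡ (trans (sym Tr-expand) Tr≈r) ⟩
            v * r                            ∎
          r≉0 : r ≉ 0#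
          r≉0 r≈0 = D≉0 (begin
            D                   ≈⟨ solve 3 (λ D a A → D := D :+ (con 0 :* a) :* A) refl D a A ⟩
            D + (0# * a) * A    ≈⟨ +-congˡ (*-congʳ (*-congʳ r≈0)) ⟨
            D + (r * a) * A     ≈⟨ D+raA≈vr ⟩
            v * r               ≈⟨ trans (*-congˡ r≈0) (zeroʳ v) ⟩
            0#                  ∎)
          w = r ⁻¹
          rw≈1 = ⁻¹-inverseʳ r≉0
          s = 1# + w * θ
          s≈ : s ≈ w * (r + θ)
          s≈ = begin
            1# + w * θ      ≈⟨ +-congʳ rw≈1 ⟨
            r * w + w * θ   ≈⟨ solve 3 (λ r w θ → r :* w :+ w :* θ := w :* (r :+ θ)) refl r w θ ⟩
            w * (r + θ)     ∎
          s≉0 : s ≉ 0#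
          s≉0 s≈0 = *-≉0 (⁻¹-≉0 r≉0) (r+θ≉0 r∈F) (trans (sym s≈) s≈0)
          -- This is `ν₀` / (r + θ), and ν was taken as `ν₀` / A so that the factor A, lying in F,
          -- can leave the trace.
          ν₀w/s≈Ax : ν₀ * (w * s ⁻¹) ≈ A * x
          ν₀w/s≈Ax = *-cancelˡ-≉0 s≉0 (begin
            s * (ν₀ * (w * s ⁻¹))
              ≈⟨ solve 4 (λ s n w s′ → s :* (n :* (w :* s′)) := (s :* s′) :* (n :* w)) refl s ν₀ w (s ⁻¹) ⟩
            (s * s ⁻¹) * (ν₀ * w)
              ≈⟨ *-congʳ (trans (⁻¹-inverseʳ s≉0) (sym (⁻¹-inverseʳ A≉0))) ⟩
            (A * A ⁻¹) * (ν₀ * w)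
              ≈⟨ solve 4 (λ a a′ n w → (a :* a′) :* (n :* w) := a :* w :* (a′ :* n)) refl A (A ⁻¹) ν₀ w ⟩
            A * w * (A ⁻¹ * ν₀)
              ≈⟨ *-congˡ x[r+θ]≈ν ⟨
            A * w * (x * (r + θ))
              ≈⟨ solve 4 (λ a w x t → a :* w :* (x :* t) := (w :* t) :* (a :* x)) refl A w x (r + θ) ⟩
            w * (r + θ) * (A * x)
              ≈⟨ *-congʳ s≈ ⟨
            s * (A * x) ∎)
          absurd : ⊥
          absurd = v-missed (F-⁻¹ r≉0 r∈F) (begin
            Tr (ν₀ * (w * s ⁻¹)) + D * w   ≈⟨ +-congʳ (trans (Tr-cong ν₀w/s≈Ax) (Tr-* (Tr∈F _) x)) ⟩
            A * a + D * w                  ≈⟨ +-congʳ (*-identityˡ _) ⟨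
            1# * (A * a) + D * w           ≈⟨ +-congʳ (*-congʳ rw≈1) ⟨
            r * w * (A * a) + D * w        ≈⟨ solve 5 (λ r w A a D → r :* w :* (A :* a) :+ D :* w
                                                := w :* (D :+ (r :* a) :* A)) refl r w A a D ⟩
            w * (D + (r * a) * A)          ≈⟨ *-congˡ D+raA≈vr ⟩
            w * (v * r)                    ≈⟨ solve 3 (λ w v r → w :* (v :* r) := v :* (r :* w)) refl w v r ⟩
            v * (r * w)                    ≈⟨ trans (*-congˡ rw≈1) (*-identityʳ v) ⟩
            v                              ∎)

        parameters-from : Parameters
        parameters-from = record
          { θ     = θ
          ; ω     = v ⁻¹ * ω
          ; ν     = A ⁻¹ * ν₀
          ; r+θ≉0 = r+θ≉0
          ; ω≉0   = *-≉0 (⁻¹-≉0 v≉0) ω≉0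
          ; ν≉0   = *-≉0 (⁻¹-≉0 A≉0) ν₀≉0
          ; Tr-ωθ = trans (Tr-cong (*-assoc (v ⁻¹) ω θ))
                      (trans (Tr-* v⁻¹∈F (ω * θ)) (trans (*-congˡ Tr-ωθ) (zeroʳ _)))
          ; avoid = avoid
          }

  parameters : Parameters
  parameters =
    let θ , θ∉F = ∃∉F
        ω , A≉0 , Tr-ωθ , D≉0 = ∃ω θ∉F
        (v , v∈F) , v-missed = missed θ∉F A≉0 Tr-ωθ D≉0
    in parameters-from θ∉F A≉0 Tr-ωθ D≉0 v∈F (λ {w} w∈F → v-missed (w , w∈F))

-- The blocking sets

module Construction {c ℓ : Level} (K : Field c ℓ) {n : ℕ} (size : HasSize (Field.setoid K) n)
  {f : ℕ} (T : TraceMap K f) (parameters : Choice.Parameters K size T) where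

  open Field K hiding (zero)
  open PG2 K
  open FiniteField K size
  open TraceMap T
  open Choice K size T using (x-y≈0⇒x≈y; Tr-+-*; Tr-0; F-⁻¹)
  open Choice.Parameters parameters
  open Inverse size using (to; from; strictlyInverseˡ)
  open Inverse fibre-size using ()
    renaming (to to toFibre; from to fromFibre; strictlyInverseˡ to toFibre-fromFibre)
  open SetoidReasoning setoid
  open import Algebra.Solver.Ring.NaturalCoefficients.Default commutativeSemiring

  private
    module P = Setoid pointSetoid

  ζ d : Carrier
  ζ = ν * ω
  d = ζ * ω

  ζ≉0 : ζ ≉ 0#
  ζ≉0 = *-≉0 ν≉0 ω≉0

  d≉0 : d ≉ 0#
  d≉0 = *-≉0 ζ≉0 ω≉0

  vec : Carrier → Carrier → Carrier → Vector Carrier 3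
  vec x y z 0F = x
  vec x y z 1F = y
  vec x y z 2F = z

  -- The three families of points in B; a disjoint sum reduces the count to injectivity of `base`.
  Index : Set
  Index = (Fin n ⊎ Fin f) ⊎ Fin 1

  base : Index → Point
  base (inj₁ (inj₁ i)) = vec (Tr (to i) + θ) (to i) ζ , λ ≈0 → ζ≉0 (≈0 2F)
  base (inj₁ (inj₂ i)) = vec 1# (proj₁ (toFibre i)) 0# , λ ≈0 → 1≉0 (≈0 0F)
  base (inj₂ _)        = vec 0# 1# 0# , λ ≈0 → 1≉0 (≈0 1F)

  -- Proportional vectors sharing a nonzero coordinate have factor one.
  a≈k*a⇒k*x≈x : ∀ {k a x} → a ≉ 0# → a ≈ k * a → k * x ≈ x
  a≈k*a⇒k*x≈x {k} {a} {x} a≉0 a≈ka = *-cancelˡ-≉0 a≉0 (begin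
    a * (k * x) ≈⟨ solve 3 (λ a k x → a :* (k :* x) := (k :* a) :* x) refl a k x ⟩
    k * a * x   ≈⟨ *-congʳ a≈ka ⟨
    a * x       ∎)

  -- The families differ in which of the last and first coordinates vanish; within the first two, ζ
  -- or 1 is a shared coordinate that fixes the factor.
  base-injective : ∀ a b → base a ∼ base b → a ≡ b
  base-injective (inj₁ (inj₁ i)) (inj₁ (inj₁ j)) (k , _ , eq) =
    ≡.cong (inj₁ ∘ inj₁) (to-injective size (trans (eq 1F) (a≈k*a⇒k*x≈x ζ≉0 (eq 2F))))
  base-injective (inj₁ (inj₁ i)) (inj₁ (inj₂ j)) (k , _ , eq) = contradiction (trans (eq 2F) (zeroʳ k)) ζ≉0
  base-injective (inj₁ (inj₁ i)) (inj₂ _) (k , _ , eq) = contradiction (trans (eq 2F) (zeroʳ k)) ζ≉0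
  base-injective (inj₁ (inj₂ i)) (inj₁ (inj₁ j)) (k , k≉0 , eq) = contradiction (sym (eq 2F)) (*-≉0 k≉0 ζ≉0)
  base-injective (inj₁ (inj₂ i)) (inj₁ (inj₂ j)) (k , _ , eq) =
    ≡.cong (inj₁ ∘ inj₂) (to-injective fibre-size (trans (eq 1F) (a≈k*a⇒k*x≈x 1≉0 (eq 0F))))
  base-injective (inj₁ (inj₂ i)) (inj₂ _) (k , _ , eq) = contradiction (trans (eq 0F) (zeroʳ k)) 1≉0
  base-injective (inj₂ _) (inj₁ (inj₁ j)) (k , k≉0 , eq) = contradiction (sym (eq 2F)) (*-≉0 k≉0 ζ≉0)
  base-injective (inj₂ _) (inj₁ (inj₂ j)) (k , k≉0 , eq) = contradiction (sym (eq 0F)) (*-≉0 k≉0 1≉0)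
  base-injective (inj₂ 0F) (inj₂ 0F) _ = ≡.refl

  -- The collineation and disjointness of the copies of B

  σ : Point → Point
  σ (v , v≉0) = vec (v 1F) (v 2F) (d * v 0F) , λ ≈0 → v≉0 λ where
    0F → *-cancelˡ-≉0 d≉0 (trans (≈0 2F) (sym (zeroʳ d)))
    1F → ≈0 0F
    2F → ≈0 1F

  σ-cong : ∀ P Q → P ∼ Q → σ P ∼ σ Q
  σ-cong (u , _) (v , _) (k , k≉0 , eq) = k , k≉0 , λ where
    0F → eq 1F
    1F → eq 2F
    2F → trans (*-congˡ (eq 0F)) (solve 3 (λ d k x → d :* (k :* x) := k :* (d :* x)) refl d k (v 0F))

  σ-reflect : ∀ P Q → σ P ∼ σ Q → P ∼ Q
  σ-reflect (u , _) (v , _) (k , k≉0 , eq) = k , k≉0 , λ where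
    0F → *-cancelˡ-≉0 d≉0 (trans (eq 2F)
           (solve 3 (λ d k x → k :* (d :* x) := d :* (k :* x)) refl d k (v 0F)))
    1F → eq 0F
    2F → eq 1F

  σ³∼id : ∀ P → σ (σ (σ P)) ∼ P
  σ³∼id P = d , d≉0 , λ where
    0F → refl
    1F → refl
    2F → refl

  -- Only the first two cases use the choice of ω and ν. In the others a zero coordinate meets a
  -- nonzero one, or an element of trace one would be zero.
  base≁σbase : ∀ a b → ¬ base a ∼ σ (base b)
  base≁σbase (inj₁ (inj₁ i)) (inj₁ (inj₁ j)) (k , _ , eq) =
    -- The third coordinates give k = 1 / (ω t), the second then x t = ν, and the first y = ω t (Tr
    -- x + θ), with trace `Tr y`.
    avoid x (Tr∈F y) (*-cancelˡ-≉0 ω≉0 x[r+θ]) (Tr-cong (sym y≈))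
    where
    x = to i
    y = to j
    t = Tr y + θ
    kωt≈1 : k * ω * t ≈ 1#
    kωt≈1 = *-cancelˡ-≉0 ζ≉0 (begin
      ζ * (k * ω * t)   ≈⟨ solve 4 (λ z k w t → z :* (k :* w :* t) := k :* (z :* w :* t)) refl ζ k ω t ⟩
      k * (d * t)       ≈⟨ eq 2F ⟨
      ζ                 ≈⟨ *-identityʳ ζ ⟨
      ζ * 1#            ∎)
    x[r+θ] : ω * (x * t) ≈ ω * ν
    x[r+θ] = begin
      ω * (x * t)         ≈⟨ *-congˡ (*-congʳ (eq 1F)) ⟩
      ω * (k * ζ * t)     ≈⟨ solve 4 (λ w k z t → w :* (k :* z :* t) := z :* (k :* w :* t)) refl ω k ζ t ⟩
      ζ * (k * ω * t)     ≈⟨ *-congˡ kωt≈1 ⟩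
      ζ * 1#              ≈⟨ solve 2 (λ n w → n :* w :* con 1 := w :* n) refl ν ω ⟩
      ω * ν               ∎
    y≈ : y ≈ ω * (t * (Tr x + θ))
    y≈ = begin
      y                     ≈⟨ *-identityˡ y ⟨
      1# * y                ≈⟨ *-congʳ kωt≈1 ⟨
      k * ω * t * y         ≈⟨ solve 4 (λ k w t y → k :* w :* t :* y := w :* (t :* (k :* y))) refl k ω t y ⟩
      ω * (t * (k * y))     ≈⟨ *-congˡ (*-congˡ (eq 0F)) ⟨
      ω * (t * (Tr x + θ))  ∎
  -- The third coordinates give k = 1 / ω and the second x = 0, so the first leave z = ω θ, an
  -- element of trace both 1 and 0.
  base≁σbase (inj₁ (inj₁ i)) (inj₁ (inj₂ j)) (k , k≉0 , eq) = 1≉0 (begin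
    1#            ≈⟨ proj₂ (toFibre j) ⟨
    Tr z          ≈⟨ Tr-cong z≈ωθ ⟩
    Tr (ω * θ)    ≈⟨ Tr-ωθ ⟩
    0#            ∎)
    where
    x = to i
    z = proj₁ (toFibre j)
    θ≈kz : θ ≈ k * z
    θ≈kz = begin
      θ             ≈⟨ +-identityˡ θ ⟨
      0# + θ        ≈⟨ +-congʳ (trans (Tr-cong (trans (eq 1F) (zeroʳ k))) Tr-0) ⟨
      Tr x + θ      ≈⟨ eq 0F ⟩
      k * z         ∎
    kω≈1 : k * ω ≈ 1#
    kω≈1 = *-cancelˡ-≉0 ζ≉0 (begin
      ζ * (k * ω)    ≈⟨ solve 3 (λ z k w → z :* (k :* w) := k :* (z :* w :* con 1)) refl ζ k ω ⟩
      k * (d * 1#)   ≈⟨ eq 2F ⟨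
      ζ              ≈⟨ *-identityʳ ζ ⟨
      ζ * 1#         ∎)
    z≈ωθ : z ≈ ω * θ
    z≈ωθ = begin
      z             ≈⟨ *-identityˡ z ⟨
      1# * z        ≈⟨ *-congʳ kω≈1 ⟨
      k * ω * z     ≈⟨ solve 3 (λ k w z → k :* w :* z := w :* (k :* z)) refl k ω z ⟩
      ω * (k * z)   ≈⟨ *-congˡ θ≈kz ⟨
      ω * θ         ∎
  base≁σbase (inj₁ (inj₁ i)) (inj₂ _) (k , _ , eq) = ζ≉0 (trans (eq 2F) (trans (*-congˡ (zeroʳ d)) (zeroʳ k)))
  base≁σbase (inj₁ (inj₂ i)) (inj₁ (inj₁ j)) (k , k≉0 , eq) = *-≉0 k≉0 (*-≉0 d≉0 (r+θ≉0 (Tr∈F _))) (sym (eq 2F))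
  base≁σbase (inj₁ (inj₂ i)) (inj₁ (inj₂ j)) (k , k≉0 , eq) = *-≉0 k≉0 (*-≉0 d≉0 1≉0) (sym (eq 2F))
  base≁σbase (inj₁ (inj₂ i)) (inj₂ _) (k , _ , eq) = 1≉0 (begin
    1#                        ≈⟨ proj₂ (toFibre i) ⟨
    Tr (proj₁ (toFibre i))    ≈⟨ Tr-cong (trans (eq 1F) (zeroʳ k)) ⟩
    Tr 0#                     ≈⟨ Tr-0 ⟩
    0#                        ∎)
  base≁σbase (inj₂ _) (inj₁ (inj₁ j)) (k , k≉0 , eq) = *-≉0 k≉0 (*-≉0 d≉0 (r+θ≉0 (Tr∈F _))) (sym (eq 2F))
  base≁σbase (inj₂ _) (inj₁ (inj₂ j)) (k , k≉0 , eq) = *-≉0 k≉0 (*-≉0 d≉0 1≉0) (sym (eq 2F))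
  base≁σbase (inj₂ _) (inj₂ _) (k , k≉0 , eq) = *-≉0 k≉0 1≉0 (sym (eq 0F))

  rotate : Fin 3 → Point → Point
  rotate 0F P = P
  rotate 1F P = σ P
  rotate 2F P = σ (σ P)

  -- Applying σ once more turns a common point of B and σ² B into one of σ B and B.
  base≁σ²base : ∀ a b → ¬ base a ∼ σ (σ (base b))
  base≁σ²base a b eq = base≁σbase b a
    (P.trans {base b} {σ (σ (σ (base b)))} {σ (base a)}
      (P.sym {σ (σ (σ (base b)))} {base b} (σ³∼id (base b)))
      (P.sym {σ (base a)} {σ (σ (σ (base b)))} (σ-cong (base a) (σ (σ (base b))) eq)))

  rotate-base-injective : ∀ i j a b → rotate i (base a) ∼ rotate j (base b) → i ≡ j × a ≡ b
  rotate-base-injective 0F 0F a b eq = ≡.refl , base-injective a b eq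
  rotate-base-injective 0F 1F a b eq = contradiction eq (base≁σbase a b)
  rotate-base-injective 0F 2F a b eq = contradiction eq (base≁σ²base a b)
  rotate-base-injective 1F 0F a b eq =
    contradiction (P.sym {σ (base a)} {base b} eq) (base≁σbase b a)
  rotate-base-injective 1F 1F a b eq = ≡.refl , base-injective a b (σ-reflect (base a) (base b) eq)
  rotate-base-injective 1F 2F a b eq =
    contradiction (σ-reflect (base a) (σ (base b)) eq) (base≁σbase a b)
  rotate-base-injective 2F 0F a b eq =
    contradiction (P.sym {σ (σ (base a))} {base b} eq) (base≁σ²base b a)
  rotate-base-injective 2F 1F a b eq = contradiction
    (P.sym {σ (base a)} {base b} (σ-reflect (σ (base a)) (base b) eq)) (base≁σbase b a)
  rotate-base-injective 2F 2F a b eq = ≡.refl ,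
    base-injective a b (σ-reflect (base a) (base b) (σ-reflect (σ (base a)) (σ (base b)) eq))

  -- Blocking of every line by each copy of B

  base-blocks : ∀ L → ∃ λ a → base a on L
  base-blocks L@(l , _) with l 1F ≟ 0#
  ... | yes l₁≈0 = inj₂ 0F , (begin
    l 0F * 0# + l 1F * 1# + l 2F * 0# ≈⟨ +-congʳ (+-congˡ (*-congʳ l₁≈0)) ⟩
    l 0F * 0# + 0# * 1# + l 2F * 0#   ≈⟨ solve 2 (λ a b → a :* con 0 :+ con 0 :* con 1 :+ b :* con 0 := con 0)
                                           refl (l 0F) (l 2F) ⟩
    0#                                ∎)
  ... | no l₁≉0 = cases (Tr z ≟ 1#)
    where
    l₀ = l 0F
    l₁ = l 1F
    l₂ = l 2F
    divide : ∀ y → l₁ * (y * l₁ ⁻¹) ≈ y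
    divide y = begin
      l₁ * (y * l₁ ⁻¹) ≈⟨ solve 3 (λ a b c → a :* (b :* c) := b :* (a :* c)) refl l₁ y (l₁ ⁻¹) ⟩
      y * (l₁ * l₁ ⁻¹) ≈⟨ trans (*-congˡ (⁻¹-inverseʳ l₁≉0)) (*-identityʳ y) ⟩
      y                ∎
    -- The line meets the line of points with last coordinate zero in (1 , z , 0), a point of B if z
    -- has trace one.
    z = - l₀ * l₁ ⁻¹
    l₀+l₁z≈0 : l₀ + l₁ * z ≈ 0#
    l₀+l₁z≈0 = trans (+-congˡ (divide (- l₀))) (-‿inverseʳ l₀)
    cases : Dec (Tr z ≈ 1#) → ∃ λ a → base a on L
    cases (yes Trz≈1) = inj₁ (inj₂ (fromFibre (z , Trz≈1))) , (begin
      l₀ * 1# + l₁ * proj₁ (toFibre (fromFibre (z , Trz≈1))) + l₂ * 0#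
        ≈⟨ +-congʳ (+-congˡ (*-congˡ (toFibre-fromFibre (z , Trz≈1)))) ⟩
      l₀ * 1# + l₁ * z + l₂ * 0#
        ≈⟨ solve 3 (λ a b c → a :* con 1 :+ b :+ c :* con 0 := a :+ b) refl l₀ (l₁ * z) l₂ ⟩
      l₀ + l₁ * z
        ≈⟨ l₀+l₁z≈0 ⟩
      0# ∎)
    cases (no Trz≉1) = inj₁ (inj₁ (from x)) , (begin
      l₀ * (Tr (to (from x)) + θ) + l₁ * to (from x) + l₂ * ζ
        ≈⟨ +-congʳ (+-cong (*-congˡ (+-congʳ (trans (Tr-cong x≈) Trx≈s))) (*-congˡ x≈)) ⟩
      l₀ * (s + θ) + l₁ * (y + s * z) + l₂ * ζ
        ≈⟨ solve 8 (λ a b c s t y z u → a :* (s :+ t) :+ b :* (y :+ s :* z) :+ c :* u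
             := s :* (a :+ b :* z) :+ (a :* t :+ c :* u :+ b :* y)) refl l₀ l₁ l₂ s θ y z ζ ⟩
      s * (l₀ + l₁ * z) + (m + l₁ * y)
        ≈⟨ +-cong (trans (*-congˡ l₀+l₁z≈0) (zeroʳ s)) (trans (+-congˡ (divide (- m))) (-‿inverseʳ m)) ⟩
      0# + 0#
        ≈⟨ +-identityʳ 0# ⟩
      0# ∎)
      where
      -- The point (s + θ , x , ζ) is on the line exactly when x = y + s z. It remains to have s =
      -- Tr x, that is s = Tr y + s Tr z, solvable since Tr z is not 1.
      m = l₀ * θ + l₂ * ζ
      y = - m * l₁ ⁻¹
      r = 1# + - Tr z
      r≉0 : r ≉ 0#
      r≉0 r≈0 = Trz≉1 (sym (x-y≈0⇒x≈y r≈0))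
      s = Tr y * r ⁻¹
      s∈F : F s
      s∈F = F-* (Tr∈F y) (F-⁻¹ r≉0 (F-+ 1∈F (F-neg (Tr∈F z))))
      x = y + s * z
      x≈ = strictlyInverseˡ x
      Trx≈s : Tr x ≈ s
      Trx≈s = begin
        Tr (y + s * z)         ≈⟨ Tr-+-* s∈F y z ⟩
        Tr y + s * Tr z        ≈⟨ +-congʳ (trans (*-congˡ (⁻¹-inverseʳ r≉0)) (*-identityʳ (Tr y))) ⟨
        Tr y * (r * r ⁻¹) + s * Tr z
          ≈⟨ solve 4 (λ a r r′ t → a :* (r :* r′) :+ a :* r′ :* t := a :* r′ :* (r :+ t))
               refl (Tr y) r (r ⁻¹) (Tr z) ⟩
        s * (r + Tr z)         ≈⟨ *-congˡ (trans (+-assoc 1# (- Tr z) (Tr z)) (+-congˡ (-‿inverseˡ (Tr z)))) ⟩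
        s * (1# + 0#)          ≈⟨ trans (*-congˡ (+-identityʳ 1#)) (*-identityʳ s) ⟩
        s                      ∎

  -- The transposed matrix pulls a line back along σ, so that blocking by σ B reduces to blocking by
  -- B.
  σᵀ : Line → Line
  σᵀ (l , l≉0) = vec (l 2F * d) (l 0F) (l 1F) , λ ≈0 → l≉0 λ where
    0F → ≈0 1F
    1F → ≈0 2F
    2F → *-cancelˡ-≉0 d≉0 (trans (*-comm d (l 2F)) (trans (≈0 0F) (sym (zeroʳ d))))

  on-σ : ∀ P L → P on σᵀ L → σ P on L
  on-σ (v , _) (l , _) v∈l = trans
    (solve 7 (λ a b c d x y z → a :* y :+ b :* z :+ c :* (d :* x) := (c :* d) :* x :+ a :* y :+ b :* z)
      refl (l 0F) (l 1F) (l 2F) d (v 0F) (v 1F) (v 2F)) v∈l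

  rotate-base-blocks : ∀ j L → ∃ λ a → rotate j (base a) on L
  rotate-base-blocks 0F L = base-blocks L
  rotate-base-blocks 1F L =
    let a , on = base-blocks (σᵀ L) in a , on-σ (base a) L on
  rotate-base-blocks 2F L =
    let a , on = base-blocks (σᵀ (σᵀ L)) in
    a , on-σ (σ (base a)) L (on-σ (base a) (σᵀ L) on)

  -- The union of t copies of B

  module _ {t : ℕ} (t≤3 : t ≤ 3) where

    point : Fin t × Index → Point
    point (j , a) = rotate (Fin.inject≤ j t≤3) (base a)

    point-injective : ∀ x y → point x ∼ point y → x ≡ y
    point-injective (i , a) (j , b) eq
      with i≡j , ≡.refl ← rotate-base-injective (Fin.inject≤ i t≤3) (Fin.inject≤ j t≤3) a b eq
      = ≡.cong (_, a) (Fin.inject≤-injective t≤3 t≤3 i j i≡j)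

    union : PointSet
    union = record
      { member   = λ P → ∃ λ x → P ∼ point x
      ; respects = λ {P} {Q} P∼Q (x , P∼x) → x , P.trans {Q} {P} {point x} (P.sym {P} {Q} P∼Q) P∼x
      }

    -- Each of the `t` copies contributes one point of the line, and points from disjoint copies are
    -- distinct.
    union-blocks : IsBlockingSet t union
    union-blocks L = record
      { to        = λ j → let x = j , index j in
                      point x , (x , P.refl {point x}) , proj₂ (rotate-base-blocks (Fin.inject≤ j t≤3) L)
      ; cong      = λ { {i} ≡.refl → P.refl {point (i , index i)} }
      ; injective = λ {i} {j} eq → ≡.cong proj₁ (point-injective (i , index i) (j , index j) eq)
      }
      where
      index : Fin t → Index
      index j = proj₁ (rotate-base-blocks (Fin.inject≤ j t≤3) L)

    code : Fin (t ℕ.* (n ℕ.+ f ℕ.+ 1)) ↔ (Fin t × Index)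
    code = ↔-trans Fin.*↔× (↔-refl ×-↔ ↔-trans Fin.+↔⊎ (Fin.+↔⊎ ⊎-↔ ↔-refl))

    union-size : HasSize (elements union) (t ℕ.* (n ℕ.+ f ℕ.+ 1))
    union-size = bijection⇒HasSize {S = elements union}
      (λ i → point (Code.to i) , Code.to i , P.refl {point (Code.to i)})
      (λ {i} {j} eq → to-injective code (point-injective (Code.to i) (Code.to j) eq))
      (λ (Q , x , Q∼x) → Code.from x ,
        ≡.subst (λ y → point y ∼ Q) (≡.sym (Code.strictlyInverseˡ x)) (P.sym {Q} {point x} Q∼x))
      where module Code = Inverse code

open import Data.Nat using (_+_; _*_; _∸_; _^_)

theorem1p3 : ∀ {c ℓ : Level} (q h : ℕ) → IsPrimePower q → 2 ≤ h →
    (K : Field c ℓ) → HasSize (Field.setoid K) (q ^ h) →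
    ∀ (t : ℕ) → t ≡ 2 ⊎ t ≡ 3 →
    Σ (PG2.PointSet K) λ B →
    PG2.IsBlockingSet K t B ×
    HasSize (PG2.elements K B) (t * (q ^ h + q ^ (h ∸ 1) + 1))
-- With h matched as `suc m`, the exponent h ∸ 1 computes to `m`, the one in the size of the trace
-- fibre.
theorem1p3 q (suc m) (p , k , p-prime , 1≤k , ≡.refl) (s≤s 1≤m) K size t t∈23 =
  union t≤3 , union-blocks t≤3 , union-size t≤3
  where
  T : TraceMap K (q ^ m)
  T = Trace.traceMap K p-prime 1≤k 1≤m size
  open Construction K size T (Choice.parameters K size T)
  t≤3 : t ≤ 3
  t≤3 = [ (λ t≡2 → ℕ.m≤n⇒m≤1+n (ℕ.≤-reflexive t≡2)) , ℕ.≤-reflexive ]′ t∈23
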